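{- Let $\lambda=(\lambda_1,\dots,\lambda_k)$ be a pseudo-partition and let $s=(s_1,\dots,s_k)$ be a strictly increasing sequence of elements of $\{1,\dots,n\}$. Then $$\sum_{T\in\mathrm{SST}(\lambda,s)}\mathrm{wt}(T)=\Big(\prod_{i=1}^k x_{s_i}\Big)\det\Big(h_{\lambda_j-j+i-1}(x_1,x_2,\dots,x_{s_j})\Big)_{i,j\in\{1,\dots,k\}}.$$
   Context: A pseudo-partition is a tuple $\lambda=(\lambda_1,\dots,\lambda_k)$ of positive integers such that $\lambda_i+1\ge\lambda_{i+1}$ for all $i\in\{1,\dots,k-1\}$. Its diagram is $D(\lambda)=\{(i,j)\in\{1,\dots,k\}\times\{1,2,\dots\}: j\le\lambda_i\}$. A tableau of shape $\lambda$ is a map $T:D(\lambda)\to\{1,2,3,\dots\}$; it is semistandard if $T(i,j_1)\le T(i,j_2)$ whenever $j_1<j_2$ (both cells in $D(\lambda)$) and $T(i_1,j)<T(i_2,j)$ whenever $i_1<i_2$ (both cells in $D(\lambda)$, regardless of whether intermediate cells exist). The surface of $T$ is $(T(1,\lambda_1),\dots,T(k,\lambda_k))$. $\mathrm{SST}(\lambda,s)$ is the set of semistandard tableaux of shape $\lambda$ with surface $s$. For a tableau with entries in $\{1,\dots,n\}$, $\mathrm{wt}(T)=\prod_{(i,j)\in D(\lambda)}x_{T(i,j)}$, with $x_1,\dots,x_n$ commuting indeterminates. $h_m$ is the complete homogeneous symmetric polynomial, with $h_0=1$ and $h_m=0$ for $m<0$. -}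

module Defs where

open import Level using (Level)
open import Data.Nat as ℕ using (ℕ; zero; suc; _∸_)
import Data.Nat.Properties as ℕP
open import Data.Integer as ℤ using (ℤ; +_; -[1+_])
open import Data.Fin as Fin using (Fin; toℕ; punchIn)
open import Data.Fin.Properties using (all?; _≤?_; _<?_)
open import Data.Vec as Vec using (Vec; []; _∷_; lookup)
open import Data.List as List using (List; []; _∷_; _++_; concatMap; filter)
open import Data.Product using (_×_; _,_)
open import Relation.Binary.PropositionalEquality using (_≡_)
open import Relation.Nullary using (Dec; _×-dec_; _→-dec_)
open import Algebra.Bundles using (CommutativeRing)

-- Combinatorial data (entries 1..n of the paper are encoded as Fin n,
-- i.e. the value v : Fin n stands for the integer toℕ v + 1; likewise
-- row/column index i : Fin k stands for toℕ i + 1).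

IsPseudoPartition : (k : ℕ) → (Fin k → ℕ) → Set
IsPseudoPartition k lam =
  ((i : Fin k) → 1 ℕ.≤ lam i) ×
  ((i j : Fin k) → toℕ j ≡ suc (toℕ i) → lam j ℕ.≤ suc (lam i))

StrictlyIncreasing : {k n : ℕ} → (Fin k → Fin n) → Set
StrictlyIncreasing {k} s = (i j : Fin k) → i Fin.< j → s i Fin.< s j

Tableau : (n k : ℕ) → (Fin k → ℕ) → Set
Tableau n k lam = (i : Fin k) → Vec (Fin n) (lam i)

RowsWeak : {n k : ℕ} {lam : Fin k → ℕ} → Tableau n k lam → Set
RowsWeak {n} {k} {lam} T =
  (i : Fin k) (j₁ j₂ : Fin (lam i)) → j₁ Fin.< j₂ → lookup (T i) j₁ Fin.≤ lookup (T i) j₂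

ColsStrict : {n k : ℕ} {lam : Fin k → ℕ} → Tableau n k lam → Set
ColsStrict {n} {k} {lam} T =
  (i₁ i₂ : Fin k) → i₁ Fin.< i₂ → (j₁ : Fin (lam i₁)) (j₂ : Fin (lam i₂)) →
  toℕ j₁ ≡ toℕ j₂ → lookup (T i₁) j₁ Fin.< lookup (T i₂) j₂

Semistandard : {n k : ℕ} {lam : Fin k → ℕ} → Tableau n k lam → Set
Semistandard T = RowsWeak T × ColsStrict T

HasSurface : {n k : ℕ} {lam : Fin k → ℕ} → Tableau n k lam → (Fin k → Fin n) → Set
HasSurface {n} {k} {lam} T s =
  (i : Fin k) (j : Fin (lam i)) → toℕ j ≡ lam i ∸ 1 → lookup (T i) j ≡ s i

InSST : {n k : ℕ} {lam : Fin k → ℕ} → (Fin k → Fin n) → Tableau n k lam → Set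
InSST s T = Semistandard T × HasSurface T s

inSST? : {n k : ℕ} {lam : Fin k → ℕ} (s : Fin k → Fin n) (T : Tableau n k lam) → Dec (InSST s T)
inSST? {n} {k} {lam} s T =
  ((all? λ i → all? λ j₁ → all? λ j₂ → (j₁ <? j₂) →-dec (lookup (T i) j₁ ≤? lookup (T i) j₂))
  ×-dec
  (all? λ i₁ → all? λ i₂ → (i₁ <? i₂) →-dec (all? λ j₁ → all? λ j₂ →
     (toℕ j₁ ℕ.≟ toℕ j₂) →-dec (lookup (T i₁) j₁ <? lookup (T i₂) j₂))))
  ×-dec
  (all? λ i → all? λ j → (toℕ j ℕ.≟ (lam i ∸ 1)) →-dec (lookup (T i) j Fin.≟ s i))

allVecs : (n m : ℕ) → List (Vec (Fin n) m)
allVecs n zero = [] ∷ []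
allVecs n (suc m) = concatMap (λ v → List.map (_∷ v) (List.allFin n)) (allVecs n m)

allTableaux : (n k : ℕ) (lam : Fin k → ℕ) → List (Tableau n k lam)
allTableaux n zero lam = (λ ()) ∷ []
allTableaux n (suc k) lam =
  concatMap (λ r → List.map (λ T → cons r T) (allTableaux n k (λ i → lam (Fin.suc i))))
            (allVecs n (lam Fin.zero))
  where
  cons : Vec (Fin n) (lam Fin.zero) → Tableau n k (λ i → lam (Fin.suc i)) → Tableau n (suc k) lam
  cons r T Fin.zero = r
  cons r T (Fin.suc i) = T i

-- SST(lam, s) as an explicit duplicate-free list
SST : (n k : ℕ) (lam : Fin k → ℕ) (s : Fin k → Fin n) → List (Tableau n k lam)
SST n k lam s = filter (inSST? s) (allTableaux n k lam)

-- weakly increasing vectors (multisets of size m)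
WeaklyIncreasing : {n m : ℕ} → Vec (Fin n) m → Set
WeaklyIncreasing {n} {m} v = (a b : Fin m) → a Fin.< b → lookup v a Fin.≤ lookup v b

-- all entries are among the first r values, i.e. ≤ r in 1-based terms
BoundedBy : {n m : ℕ} → ℕ → Vec (Fin n) m → Set
BoundedBy {n} {m} r v = (a : Fin m) → toℕ (lookup v a) ℕ.< r

monomialsOK? : {n m : ℕ} (r : ℕ) (v : Vec (Fin n) m) → Dec (WeaklyIncreasing v × BoundedBy r v)
monomialsOK? r v =
  (all? λ a → all? λ b → (a <? b) →-dec (lookup v a ≤? lookup v b))
  ×-dec (all? λ a → toℕ (lookup v a) ℕ.<? r)

-- the monomials of degree m in x₁,…,x_r (as weakly increasing index vectors)
monomials : (n r m : ℕ) → List (Vec (Fin n) m)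
monomials n r m = filter (monomialsOK? r) (allVecs n m)

module WithRing {c ℓ : Level} (R : CommutativeRing c ℓ) where
  open CommutativeRing R

  sumL : List Carrier → Carrier
  sumL = List.foldr _+_ 0#

  ΣFin : (k : ℕ) → (Fin k → Carrier) → Carrier
  ΣFin zero f = 0#
  ΣFin (suc k) f = f Fin.zero + ΣFin k (λ i → f (Fin.suc i))

  ΠFin : (k : ℕ) → (Fin k → Carrier) → Carrier
  ΠFin zero f = 1#
  ΠFin (suc k) f = f Fin.zero * ΠFin k (λ i → f (Fin.suc i))

  sign : ℕ → Carrier
  sign zero = 1#
  sign (suc j) = - sign j

  det : (k : ℕ) → (Fin k → Fin k → Carrier) → Carrier
  det zero M = 1#
  det (suc k) M =
    ΣFin (suc k) (λ j → sign (toℕ j) * (M Fin.zero j *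
      det k (λ a b → M (Fin.suc a) (punchIn j b))))

  wt : {n k : ℕ} {lam : Fin k → ℕ} → (Fin n → Carrier) → Tableau n k lam → Carrier
  wt {n} {k} {lam} x T = ΠFin k (λ i → ΠFin (lam i) (λ j → x (lookup (T i) j)))

  hN : {n : ℕ} → (Fin n → Carrier) → (r m : ℕ) → Carrier
  hN {n} x r m = sumL (List.map (λ v → ΠFin m (λ a → x (lookup v a))) (monomials n r m))

  h : {n : ℕ} → (Fin n → Carrier) → (r : ℕ) → ℤ → Carrier
  h x r (+ m) = hN x r m
  h x r -[1+ m ] = 0#

{-# OPTIONS --safe #-}
module Submission where

-- Delete the surface: put μ = λ − 1 and let T range over the fillings of the diagram of μ
-- which become semistandard when the surface is put back.  Writing σ_i for the number
-- of values allowed in row i, both this generating function and the determinant satisfy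
--   X(μ, σ) = X(μ, σ with σ_j lowered) + x_{σ_j} X(μ with μ_j lowered, σ),
-- the determinant because h_m(x_1..x_r) = h_m(x_1..x_{r-1}) + x_r h_{m-1}(x_1..x_r),
-- the tableaux by asking whether the last entry of row j is σ_j.  The latter is valid when j is the
-- first index with μ_{j+1} ≤ μ_j.  As μ_1, …, μ_j are then consecutive integers, lowering σ_j
-- onto σ_{j-1} makes two columns of the determinant equal and leaves no tableaux.
-- If μ_j = 0, then j = 1 and the first row can be dropped on both sides.

open import Defs
open import Data.Bool using (true; false; if_then_else_)
open import Data.Nat as ℕ using (ℕ; zero; suc; _≤_; _<_; s≤s; z≤n; _∸_)
import Data.Nat.Properties as ℕ
import Data.Integer as ℤ
import Data.Integer.Properties as ℤ
import Data.Integer.Tactic.RingSolver as ℤ-Solver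
open import Data.Fin as Fin using (Fin; zero; suc; toℕ; punchIn; inject₁)
import Data.Fin.Properties as Fin
open import Data.List as List using (List; []; _∷_; _++_; map; concatMap; filter)
import Data.List.Properties as List
open import Data.List.Membership.Propositional using (_∈_; find)
open import Data.List.Membership.Propositional.Properties using (∈-map⁺; ∈-map⁻; ∈-++⁺ˡ; ∈-++⁺ʳ; ∈-++⁻)
open import Data.List.Relation.Binary.Permutation.Propositional as ↭ using (_↭_; prep; swap)
import Data.List.Relation.Binary.Permutation.Propositional.Properties as ↭
import Data.List.Relation.Unary.All as All
open import Data.List.Relation.Unary.Any using (Any; here; there)
open import Data.Product using (_×_; _,_; proj₁; proj₂; ∃; map₁)
open import Data.Sum using (_⊎_; inj₁; inj₂)
open import Data.Vec using (Vec; []; _∷_; lookup)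
open import Data.Vec.Functional using (tail; foldr; updateAt)
import Data.Vec.Functional.Properties as Vector
open import Function using (_∘_; _⇔_; mk⇔; const)
open import Relation.Binary.PropositionalEquality
  using (_≡_; _≢_; refl; sym; trans; cong; cong₂; subst; subst₂; module ≡-Reasoning)
open import Relation.Nullary using (Dec; yes; no; ¬_; contradiction; map′; _×-dec_; _→-dec_; does)
open import Relation.Nullary.Decidable using (does-⇔; dec-false; dec-true)
open import Algebra.Bundles using (CommutativeRing)
open import Level using (Level)

-- Sequences

-- Lowering σ_j tightens the bound on row j but relaxes the one that the surface cell of row j puts
-- on the cells below it. No filling is gained, because μ climbs by at most one per row: after
-- μ_{j+1} ≤ μ_j, a row that reaches beyond μ_j comes after another row whose surface cell lies in
-- the same column, and that bound is stronger. The same inequality keeps the shape slow once the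
-- last cell of row j is gone. The lowered σ may repeat a value, so fillings are cut out by
-- inequalities (`Bounds`) that make sense for every σ. A filling is a list of cells with values,
-- judged by membership only, so any cell can be moved to the front and summed over first.
-- h_m(x_1..x_r) is the sum for a single row, and its recurrence is the case k = 1 of the one for
-- tableaux. The induction is on k, then on the sum of all μ_i and σ_i, which both branches lower by
-- one. Besides the empty first row it can end with σ_1 = 0 and a nonempty first row, where both
-- sides vanish.

Slow : {k : ℕ} → (Fin k → ℕ) → Set
Slow μ = ∀ i j → toℕ j ≡ suc (toℕ i) → μ j ≤ suc (μ i)

Increasing : {k : ℕ} → (Fin k → ℕ) → Set
Increasing σ = ∀ i j → i Fin.< j → σ i < σ j

-- A relation instead of an update, so that the constant one-row sequences behind h_m fit it without
-- function extensionality.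
LowersAt : {k : ℕ} → Fin k → (f g : Fin k → ℕ) → Set
LowersAt j f g = f j ≡ suc (g j) × (∀ i → i ≢ j → f i ≡ g i)

-- Holds at the first index at which a slow μ does not step up, and is all that the recurrence needs.
record Peak {k : ℕ} (μ : Fin k → ℕ) (j : Fin k) : Set where
  field
    rises    : ∀ i → i Fin.< j → μ i < μ j
    stepsUp  : ∀ i → toℕ j ≡ suc (toℕ i) → μ j ≡ suc (μ i)
    descends : ∀ i → toℕ i ≡ suc (toℕ j) → μ i ≤ μ j

open Peak

slow-tail : {k : ℕ} {μ : Fin (suc k) → ℕ} → Slow μ → Slow (tail μ)
slow-tail slow i j e = slow (suc i) (suc j) (cong suc e)

peak-suc : {k : ℕ} {μ : Fin (suc (suc k)) → ℕ} → μ (suc zero) ≡ suc (μ zero) →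
  ∀ {j} → Peak (tail μ) j → Peak μ (suc j)
peak-suc {μ = μ} μ₁≡ {j} p = λ where
    .rises zero _ → ℕ.<-≤-trans (ℕ.≤-reflexive (sym μ₁≡)) (first≤ j p)
    .rises (suc i) (s≤s i<j) → rises p i i<j
    .stepsUp zero e → stepsUp₀ j (ℕ.suc-injective e)
    .stepsUp (suc i) e → stepsUp p i (ℕ.suc-injective e)
    .descends zero ()
    .descends (suc i) e → descends p i (ℕ.suc-injective e)
  where
  first≤ : ∀ j → Peak (tail μ) j → μ (suc zero) ≤ μ (suc j)
  first≤ zero    p = ℕ.≤-refl
  first≤ (suc j) p = ℕ.<⇒≤ (rises p zero (s≤s z≤n))
  stepsUp₀ : ∀ j → toℕ j ≡ 0 → μ (suc j) ≡ suc (μ zero)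
  stepsUp₀ zero _ = μ₁≡

peak : {k : ℕ} (μ : Fin (suc k) → ℕ) → Slow μ → ∃ (Peak μ)
peak {zero} μ slow = zero , λ where
  .rises i ()
  .stepsUp i ()
  .descends zero ()
peak {suc k} μ slow with μ (suc zero) ℕ.≤? μ zero
... | yes μ₁≤μ₀ = zero , λ where
  .rises i ()
  .stepsUp i ()
  .descends zero ()
  .descends (suc zero) e → μ₁≤μ₀
... | no μ₁≰μ₀ =
  let j , p = peak (tail μ) (slow-tail slow)
  in suc j , peak-suc (ℕ.≤-antisym (slow zero (suc zero) refl) (ℕ.≰⇒> μ₁≰μ₀)) p

-- Discrete intermediate values: a sequence that climbs by at most one cannot jump over `m`.
slow-hits : {k : ℕ} (μ : Fin (suc k) → ℕ) → Slow μ → ∀ {m} → μ zero ≤ m →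
  ∀ i → m < μ i → ∃ λ i′ → i′ Fin.< i × μ i′ ≡ m
slow-hits μ slow μ₀≤m zero    m<μ = contradiction m<μ (ℕ.≤⇒≯ μ₀≤m)
slow-hits {suc k} μ slow {m} μ₀≤m (suc i) m<μ with μ zero ℕ.≟ m
... | yes μ₀≡m = zero , s≤s z≤n , μ₀≡m
... | no  μ₀≢m =
  let i′ , i′<i , e = slow-hits (tail μ) (slow-tail slow)
                        (ℕ.≤-trans (slow zero (suc zero) refl) (ℕ.≤∧≢⇒< μ₀≤m μ₀≢m)) i m<μ
  in suc i′ , s≤s i′<i , e

-- Right after `j` the sequence is at or below `μ j`, so `slow-hits` applies to what follows. In the
-- diagram, the rim cells of rows `i′` and `j` share a column.
returns : {k : ℕ} (μ : Fin k → ℕ) → Slow μ →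
  ∀ j → (∀ i → toℕ i ≡ suc (toℕ j) → μ i ≤ μ j) →
  ∀ i → j Fin.< i → μ j < μ i → ∃ λ i′ → j Fin.< i′ × i′ Fin.< i × μ i′ ≡ μ j
returns {suc (suc k)} μ slow zero desc (suc i) _ μ₀<μ =
  let i′ , i′<i , e = slow-hits (tail μ) (slow-tail slow) (desc (suc zero) refl) i μ₀<μ
  in suc i′ , s≤s z≤n , s≤s i′<i , e
returns μ slow (suc j) desc (suc i) (s≤s j<i) μ<μ =
  let i′ , j<i′ , i′<i , e = returns (tail μ) (slow-tail slow) j
                               (λ i e → desc (suc i) (cong suc e)) i j<i μ<μ
  in suc i′ , s≤s j<i′ , s≤s i′<i , e

total : {k : ℕ} → (Fin k → ℕ) → ℕ
total = foldr ℕ._+_ 0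

total-cong : {k : ℕ} {f g : Fin k → ℕ} → (∀ i → f i ≡ g i) → total f ≡ total g
total-cong {zero}  eq = refl
total-cong {suc k} eq = cong₂ ℕ._+_ (eq zero) (total-cong (eq ∘ suc))

total-lowers : {k : ℕ} {j : Fin k} {f g : Fin k → ℕ} → LowersAt j f g → total f ≡ suc (total g)
total-lowers {suc k} {zero} (eq , same) =
  cong₂ ℕ._+_ eq (total-cong (λ i → same (suc i) λ ()))
total-lowers {suc k} {suc j} {f} {g} (eq , same) = trans
  (cong₂ ℕ._+_ (same zero λ ())
               (total-lowers {j = j} (eq , λ i i≢j → same (suc i) (i≢j ∘ Fin.suc-injective))))
  (ℕ.+-suc _ _)

fin1-peak : (μ : Fin 1 → ℕ) → Peak μ zero
fin1-peak μ = λ where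
  .rises i ()
  .stepsUp i ()
  .descends zero ()

fin1-slow : (μ : Fin 1 → ℕ) → Slow μ
fin1-slow μ i zero ()

fin1-increasing : (σ : Fin 1 → ℕ) → Increasing σ
fin1-increasing σ zero zero ()

fin1-lowers : (m : ℕ) → LowersAt {1} zero (const (suc m)) (const m)
fin1-lowers m = refl , λ { zero 0≢0 → contradiction refl 0≢0 }

lowered : {k : ℕ} (f : Fin k → ℕ) (j : Fin k) {m : ℕ} → f j ≡ suc m → LowersAt j f (updateAt f j (const m))
lowered f j e =
  trans e (cong suc (sym (Vector.updateAt-updates j f))) ,
  λ i i≢j → sym (Vector.updateAt-minimal i j f i≢j)

lowers-≤ : {k : ℕ} {j : Fin k} {f g : Fin k → ℕ} → LowersAt j f g → ∀ i → g i ≤ f i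
lowers-≤ {j = j} {f} {g} (eq , same) i with i Fin.≟ j
... | yes refl = subst (g j ≤_) (sym eq) (ℕ.n≤1+n _)
... | no  i≢j  = ℕ.≤-reflexive (sym (same i i≢j))

slow-bound : {k : ℕ} (μ : Fin (suc k) → ℕ) → Slow μ → ∀ i → μ i ≤ μ zero ℕ.+ toℕ i
slow-bound μ slow zero = ℕ.m≤m+n _ 0
slow-bound {suc k} μ slow (suc i) = ℕ.≤-trans (slow-bound (tail μ) (slow-tail slow) i)
  (ℕ.≤-trans (ℕ.+-monoˡ-≤ (toℕ i) (slow zero (suc zero) refl))
             (ℕ.≤-reflexive (sym (ℕ.+-suc (μ zero) (toℕ i)))))

-- Only the step out of `j` can become too steep, and `descends` leaves exactly the room it needs.
slow-lowers : {k : ℕ} {j : Fin k} {μ μ′ : Fin k → ℕ} → Slow μ → Peak μ j → LowersAt j μ μ′ → Slow μ′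
slow-lowers {j = j} {μ} {μ′} slow pk (eq , same) i i′ e with i Fin.≟ j | i′ Fin.≟ j
... | yes refl | yes refl = ℕ.n≤1+n _
... | yes refl | no i′≢j = subst₂ _≤_ (same i′ i′≢j) eq (descends pk i′ e)
... | no i≢j | yes refl = ℕ.≤-trans (ℕ.n≤1+n _) (subst₂ _≤_ eq (cong suc (same i i≢j)) (slow i i′ e))
... | no i≢j | no i′≢j = subst₂ _≤_ (same i′ i′≢j) (cong suc (same i i≢j)) (slow i i′ e)

increasing-lowers : {k : ℕ} {j : Fin k} {σ σ′ : Fin k → ℕ} → Increasing σ → LowersAt j σ σ′ →
  (∀ i → i Fin.< j → σ i < σ′ j) → Increasing σ′
increasing-lowers {j = j} {σ} {σ′} inc (eq , same) below i i′ i<i′ with i Fin.≟ j | i′ Fin.≟ j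
... | yes refl | yes refl = contradiction i<i′ (ℕ.<-irrefl refl)
... | yes refl | no i′≢j = subst (σ′ i <_) (same i′ i′≢j)
      (ℕ.<-trans (ℕ.≤-reflexive (sym eq)) (inc i i′ i<i′))
... | no i≢j | yes refl = subst (_< σ′ j) (same i i≢j) (below i i<i′)
... | no i≢j | no i′≢j = subst₂ _<_ (same i i≢j) (same i′ i′≢j) (inc i i′ i<i′)

-- Since `σ` increases strictly, the lowered value is still at least its left neighbour; equality
-- there is the only obstruction.
collides? : {k : ℕ} {σ σ′ : Fin (suc k) → ℕ} (j : Fin (suc k)) → Increasing σ → LowersAt j σ σ′ →
  (∀ i → i Fin.< j → σ i < σ′ j) ⊎ (∃ λ p → j ≡ suc p × σ′ j ≡ σ (inject₁ p))
collides? zero inc _ = inj₁ λ _ ()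
collides? {σ = σ} {σ′} (suc p) inc (eq , same) with σ′ (suc p) ℕ.≟ σ (inject₁ p)
... | yes e = inj₂ (p , refl , e)
... | no ne = inj₁ below
  where
  inject₁p< : inject₁ p Fin.< suc p
  inject₁p< = s≤s (ℕ.≤-reflexive (Fin.toℕ-inject₁ p))
  σp<σ′ : σ (inject₁ p) < σ′ (suc p)
  σp<σ′ = ℕ.≤∧≢⇒< (ℕ.≤-pred (subst (σ (inject₁ p) <_) eq (inc _ _ inject₁p<))) (ne ∘ sym)
  below : ∀ i → i Fin.< suc p → σ i < σ′ (suc p)
  below i (s≤s i≤p) with i Fin.≟ inject₁ p
  ... | yes refl = σp<σ′
  ... | no i≢ = ℕ.<-trans (inc i (inject₁ p) (ℕ.≤∧≢⇒<
      (subst (toℕ i ≤_) (sym (Fin.toℕ-inject₁ p)) i≤p) (i≢ ∘ Fin.toℕ-injective))) σp<σ′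

-- Fillings of finite sets of cells

Cell : ℕ → Set
Cell k = Fin k × ℕ

rowCells : {k : ℕ} → Fin k → (c m : ℕ) → List (Cell k)
rowCells i c zero    = []
rowCells i c (suc m) = (i , c) ∷ rowCells i (suc c) m

cells : {k : ℕ} → (Fin k → ℕ) → List (Cell k)
cells {zero}  μ = []
cells {suc k} μ = rowCells zero 0 (μ zero) ++ map (map₁ suc) (cells (tail μ))

-- Rows are generated from the left while the recurrence splits off the last cell; hence a
-- permutation.
rowCells-snoc : {k : ℕ} (i : Fin k) (c m : ℕ) → rowCells i c (suc m) ↭ (i , c ℕ.+ m) ∷ rowCells i c m
rowCells-snoc i c zero    rewrite ℕ.+-identityʳ c = ↭.refl
rowCells-snoc i c (suc m) rewrite ℕ.+-suc c m =
  ↭.trans (prep _ (rowCells-snoc i (suc c) m)) (swap _ _ ↭.refl)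

rowCells-⊆ : {k : ℕ} {i : Fin k} (c m : ℕ) {p : Cell k} →
  p ∈ rowCells i c m → proj₁ p ≡ i × proj₂ p < c ℕ.+ m
rowCells-⊆ c (suc m) (here refl) = refl , ℕ.m<m+n c (s≤s z≤n)
rowCells-⊆ c (suc m) (there p∈) rewrite ℕ.+-suc c m = rowCells-⊆ (suc c) m p∈

cells-⊆ : {k : ℕ} (μ : Fin k → ℕ) {p : Cell k} → p ∈ cells μ → proj₂ p < μ (proj₁ p)
cells-⊆ {suc k} μ p∈ with ∈-++⁻ (rowCells zero 0 (μ zero)) p∈
... | inj₁ p∈row with rowCells-⊆ 0 _ p∈row
...   | refl , c<μ = c<μ
cells-⊆ {suc k} μ p∈ | inj₂ p∈rest with ∈-map⁻ (map₁ suc) p∈rest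
... | q , q∈ , refl = cells-⊆ (tail μ) q∈

cells-cong : {k : ℕ} {μ ν : Fin k → ℕ} → (∀ i → μ i ≡ ν i) → cells μ ≡ cells ν
cells-cong {zero}  eq = refl
cells-cong {suc k} eq =
  cong₂ _++_ (cong (rowCells zero 0) (eq zero)) (cong (map (map₁ suc)) (cells-cong (eq ∘ suc)))

cells-lowers : {k : ℕ} {j : Fin k} {μ ν : Fin k → ℕ} → LowersAt j μ ν → cells μ ↭ (j , ν j) ∷ cells ν
cells-lowers {suc k} {zero} {μ} {ν} (eq , same) rewrite eq =
  ↭.++⁺ (rowCells-snoc zero 0 (ν zero))
        (↭.↭-reflexive (cong (map (map₁ suc)) (cells-cong (λ i → same (suc i) λ ()))))
cells-lowers {suc k} {suc j} {μ} {ν} (eq , same) rewrite same zero (λ ()) = ↭.trans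
  (↭.++⁺ˡ (rowCells zero 0 (ν zero)) (↭.map⁺ (map₁ suc)
     (cells-lowers {j = j} (eq , λ i i≢j → same (suc i) (i≢j ∘ Fin.suc-injective)))))
  (↭.shift _ (rowCells zero 0 (ν zero)) _)

-- The cells that the surface adds to the diagram of μ.
rim : {k : ℕ} → (Fin k → ℕ) → List (Cell k)
rim {zero}  μ = []
rim {suc k} μ = (zero , μ zero) ∷ map (map₁ suc) (rim (tail μ))

∈-rim⁺ : {k : ℕ} (μ : Fin k → ℕ) (i : Fin k) → (i , μ i) ∈ rim μ
∈-rim⁺ μ zero    = here refl
∈-rim⁺ μ (suc i) = there (∈-map⁺ (map₁ suc) (∈-rim⁺ (tail μ) i))

∈-rim⁻ : {k : ℕ} (μ : Fin k → ℕ) {p : Cell k} → p ∈ rim μ → proj₂ p ≡ μ (proj₁ p)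
∈-rim⁻ {suc k} μ (here refl) = refl
∈-rim⁻ {suc k} μ (there p∈) with ∈-map⁻ (map₁ suc) p∈
... | q , q∈ , refl = ∈-rim⁻ (tail μ) q∈

cells-rim : {k : ℕ} {lam μ : Fin k → ℕ} → (∀ i → lam i ≡ suc (μ i)) → cells lam ↭ rim μ ++ cells μ
cells-rim {zero} eq = ↭.refl
cells-rim {suc k} {lam} {μ} eq rewrite eq zero = ↭.trans
  (↭.++⁺ (rowCells-snoc zero 0 (μ zero)) (↭.map⁺ (map₁ suc) (cells-rim (eq ∘ suc))))
  (prep _ (↭.trans
    (↭.↭-reflexive (cong (rowCells zero 0 (μ zero) ++_) (List.map-++ (map₁ suc) (rim (tail μ)) _)))
    (↭.shifts (rowCells zero 0 (μ zero)) (map (map₁ suc) (rim (tail μ))))))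

module _ {n : ℕ} where

  Entry : ℕ → Set
  Entry k = Cell k × Fin n

  Compatible : {k : ℕ} → Entry k → Entry k → Set
  Compatible ((i , c) , v) ((i′ , c′) , v′) =
    (i ≡ i′ → c < c′ → v Fin.≤ v′) × (i Fin.< i′ → c ≡ c′ → v Fin.< v′)

  Semistd : {k : ℕ} → List (Entry k) → Set
  Semistd F = ∀ {p q} → p ∈ F → q ∈ F → Compatible p q

  -- The first condition compares the entry with the rim cell of its own row, the second with the
  -- rim cells above it in its column. Rim cells below it are covered by the first condition when
  -- `σ` increases.
  Bounds : {k : ℕ} (μ σ : Fin k → ℕ) → Entry k → Set
  Bounds μ σ ((i , c) , v) = toℕ v < σ i × (∀ i′ → i′ Fin.< i → c ≡ μ i′ → σ i′ ≤ toℕ v)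

  -- F together with the entries σ i ∸ 1 on the rim of μ is semistandard
  -- (σ being increasing, and all cells of F lying in the diagram of μ).
  Good : {k : ℕ} (μ σ : Fin k → ℕ) → List (Entry k) → Set
  Good μ σ F = Semistd F × (∀ {p} → p ∈ F → Bounds μ σ p)

  InDiagram : {k : ℕ} → (Fin k → ℕ) → List (Entry k) → Set
  InDiagram μ F = ∀ {i c v} → ((i , c) , v) ∈ F → c < μ i

  compatible? : {k : ℕ} (p q : Entry k) → Dec (Compatible p q)
  compatible? ((i , c) , v) ((i′ , c′) , v′) =
    ((i Fin.≟ i′) →-dec ((c ℕ.<? c′) →-dec (v Fin.≤? v′)))
    ×-dec ((i Fin.<? i′) →-dec ((c ℕ.≟ c′) →-dec (v Fin.<? v′)))

  semistd? : {k : ℕ} (F : List (Entry k)) → Dec (Semistd F)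
  semistd? F = map′ (λ a p∈ q∈ → All.lookup (All.lookup a p∈) q∈)
                    (λ f → All.tabulate (λ p∈ → All.tabulate (f p∈)))
                    (All.all? (λ p → All.all? (compatible? p) F) F)

  bounds? : {k : ℕ} (μ σ : Fin k → ℕ) (p : Entry k) → Dec (Bounds μ σ p)
  bounds? μ σ ((i , c) , v) =
    (toℕ v ℕ.<? σ i)
    ×-dec Fin.all? (λ i′ → (i′ Fin.<? i) →-dec ((c ℕ.≟ μ i′) →-dec (σ i′ ℕ.≤? toℕ v)))

  good? : {k : ℕ} (μ σ : Fin k → ℕ) (F : List (Entry k)) → Dec (Good μ σ F)
  good? μ σ F = semistd? F ×-dec map′ All.lookup All.tabulate (All.all? (bounds? μ σ) F)

  inDiagram : {k : ℕ} (μ : Fin k → ℕ) {F : List (Entry k)} → map proj₁ F ≡ cells μ → InDiagram μ F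
  inDiagram μ eq p∈ = cells-⊆ μ (subst (_ ∈_) eq (∈-map⁺ proj₁ p∈))

  semistd-resp-↭ : {k : ℕ} {F G : List (Entry k)} → F ↭ G → Semistd F → Semistd G
  semistd-resp-↭ F↭G semi p∈ q∈ =
    semi (↭.∈-resp-↭ (↭.↭-sym F↭G) p∈) (↭.∈-resp-↭ (↭.↭-sym F↭G) q∈)

  good-resp-↭ : {k : ℕ} {μ σ : Fin k → ℕ} {F G : List (Entry k)} → F ↭ G → Good μ σ F → Good μ σ G
  good-resp-↭ F↭G (semi , bnd) =
    semistd-resp-↭ F↭G semi , bnd ∘ ↭.∈-resp-↭ (↭.↭-sym F↭G)

  -- Fillings with the last cell of the peak row singled out

  module Recurrence {k : ℕ} {μ μ′ σ σ′ : Fin k → ℕ} {j : Fin k}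
    (slow : Slow μ) (peak : Peak μ j) (inc : Increasing σ)
    (μ↓ : LowersAt j μ μ′) (σ↓ : LowersAt j σ σ′)
    {F : List (Entry k)} (F⊆μ′ : InDiagram μ′ F) (a : Fin n) where

    corner : Entry k
    corner = (j , μ′ j) , a

    F⊆μ : InDiagram μ (corner ∷ F)
    F⊆μ (here refl) = ℕ.≤-reflexive (sym (proj₁ μ↓))
    F⊆μ (there p∈)  = ℕ.<-≤-trans (F⊆μ′ p∈) (lowers-≤ μ↓ _)

    -- The lower bound which the rim cell of row j imposes is implied by that of a later row.
    implied-bound : ∀ {i c} {v : Fin n} → c < μ i → j Fin.< i → c ≡ μ j →
      (∀ i′ → i′ ≢ j → i′ Fin.< i → c ≡ μ i′ → σ i′ ≤ toℕ v) → σ j ≤ toℕ v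
    implied-bound {i} c<μ j<i refl lower =
      let i′ , j<i′ , i′<i , e = returns μ slow j (descends peak) i j<i c<μ
      in ℕ.≤-trans (ℕ.<⇒≤ (inc j i′ j<i′)) (lower i′ (λ i′≡j → Fin.<⇒≢ j<i′ (sym i′≡j)) i′<i (sym e))

    -- The last entry of a row bounds the whole row, so the lower ceiling excludes nothing once the
    -- corner respects it. Backwards, the bound that was relaxed below rim cell `j` is recovered by
    -- `implied-bound`.
    corner-below : toℕ a ≢ σ′ j → Good μ σ (corner ∷ F) ⇔ Good μ σ′ (corner ∷ F)
    corner-below a≢ = mk⇔ to from
      where
      to : Good μ σ (corner ∷ F) → Good μ σ′ (corner ∷ F)
      to (semi , bnd) = semi , λ p∈ → upper p∈ , λ i′ i′<i e → ℕ.≤-trans (lowers-≤ σ↓ i′) (proj₂ (bnd p∈) i′ i′<i e)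
        where
        a<σ′ : toℕ a < σ′ j
        a<σ′ = ℕ.≤∧≢⇒< (ℕ.≤-pred (subst (toℕ a <_) (proj₁ σ↓) (proj₁ (bnd (here refl))))) a≢
        upper : ∀ {i c v} → ((i , c) , v) ∈ corner ∷ F → toℕ v < σ′ i
        upper (here refl) = a<σ′
        upper {i} (there p∈) with i Fin.≟ j
        ... | yes refl = ℕ.≤-<-trans (proj₁ (semi (there p∈) (here refl)) refl (F⊆μ′ p∈)) a<σ′
        ... | no  i≢j  = subst (_ <_) (proj₂ σ↓ i i≢j) (proj₁ (bnd (there p∈)))
      from : Good μ σ′ (corner ∷ F) → Good μ σ (corner ∷ F)
      from (semi , bnd) = semi , λ p∈ → ℕ.<-≤-trans (proj₁ (bnd p∈)) (lowers-≤ σ↓ _) , lower p∈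
        where
        lower′ : ∀ {i c v} → ((i , c) , v) ∈ corner ∷ F → ∀ i′ → i′ ≢ j → i′ Fin.< i → c ≡ μ i′ → σ i′ ≤ toℕ v
        lower′ p∈ i′ i′≢j i′<i e = subst (_≤ _) (sym (proj₂ σ↓ i′ i′≢j)) (proj₂ (bnd p∈) i′ i′<i e)
        lower : ∀ {i c v} → ((i , c) , v) ∈ corner ∷ F → ∀ i′ → i′ Fin.< i → c ≡ μ i′ → σ i′ ≤ toℕ v
        lower p∈ i′ i′<i e with i′ Fin.≟ j
        ... | yes refl = implied-bound (F⊆μ p∈) i′<i e (lower′ p∈)
        ... | no i′≢j  = lower′ p∈ i′ i′≢j i′<i e

    corner-above : toℕ a ≡ σ′ j → ¬ Good μ σ′ (corner ∷ F)
    corner-above a≡ (_ , bnd) = ℕ.<⇒≢ (proj₁ (bnd (here refl))) a≡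

    -- The corner holds precisely the value prescribed for the rim cell of row `j` of `μ′`.
    -- Comparisons with the corner thus turn into conditions of `Bounds μ′ σ`, and back.
    corner-max : toℕ a ≡ σ′ j → Good μ σ (corner ∷ F) ⇔ Good μ′ σ F
    corner-max a≡ = mk⇔ to from
      where
      σj≡ : σ j ≡ suc (toℕ a)
      σj≡ = trans (proj₁ σ↓) (cong suc (sym a≡))
      to : Good μ σ (corner ∷ F) → Good μ′ σ F
      to (semi , bnd) = (λ p∈ q∈ → semi (there p∈) (there q∈)) , λ p∈ → proj₁ (bnd (there p∈)) , lower p∈
        where
        lower : ∀ {i c v} → ((i , c) , v) ∈ F → ∀ i′ → i′ Fin.< i → c ≡ μ′ i′ → σ i′ ≤ toℕ v
        lower p∈ i′ i′<i e with i′ Fin.≟ j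
        ... | yes refl = subst (_≤ _) (sym σj≡) (proj₂ (semi (here refl) (there p∈)) i′<i (sym e))
        ... | no i′≢j  = proj₂ (bnd (there p∈)) i′ i′<i (trans e (sym (proj₂ μ↓ i′ i′≢j)))
      from : Good μ′ σ F → Good μ σ (corner ∷ F)
      from (semi , bnd) = compat , λ p∈ → upper p∈ , lower p∈
        where
        compat : Semistd (corner ∷ F)
        compat (here refl) (here refl) =
          (λ _ c<c → contradiction c<c (ℕ.<-irrefl refl)) , λ j<j → contradiction j<j (ℕ.<-irrefl refl)
        compat (here refl) (there q∈) =
          (λ { refl μ′<c → contradiction (F⊆μ′ q∈) (ℕ.<-asym μ′<c) }) ,
          λ j<i e → subst (_≤ _) σj≡ (proj₂ (bnd q∈) j j<i (sym e))
        compat {(i , _) , _} (there p∈) (here refl) =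
          (λ { refl _ → ℕ.≤-pred (subst (_ <_) σj≡ (proj₁ (bnd p∈))) }) ,
          -- Rows above `j` have at most `μ′ j` cells, so they end before the corner's column.
          λ { i<j refl → contradiction
                (ℕ.<-≤-trans (F⊆μ′ p∈) (ℕ.≤-trans (lowers-≤ μ↓ _) (ℕ.≤-pred (subst (μ i <_) (proj₁ μ↓) (rises peak i i<j)))))
                (ℕ.<-irrefl refl) }
        compat (there p∈) (there q∈) = semi p∈ q∈
        upper : ∀ {i c v} → ((i , c) , v) ∈ corner ∷ F → toℕ v < σ i
        upper (here refl) = ℕ.≤-reflexive (sym σj≡)
        upper (there p∈)  = proj₁ (bnd p∈)
        lower′ : ∀ {i c v} → ((i , c) , v) ∈ corner ∷ F → ∀ i′ → i′ ≢ j → i′ Fin.< i → c ≡ μ i′ → σ i′ ≤ toℕ v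
        lower′ (here refl) i′ i′≢j i′<j e = ℕ.≤-pred (subst (σ i′ <_) σj≡ (inc i′ j i′<j))
        lower′ (there p∈)  i′ i′≢j i′<i e = proj₂ (bnd p∈) i′ i′<i (trans e (proj₂ μ↓ i′ i′≢j))
        lower : ∀ {i c v} → ((i , c) , v) ∈ corner ∷ F → ∀ i′ → i′ Fin.< i → c ≡ μ i′ → σ i′ ≤ toℕ v
        lower p∈ i′ i′<i e with i′ Fin.≟ j
        ... | yes refl = implied-bound (F⊆μ p∈) i′<i e (lower′ p∈)
        ... | no i′≢j  = lower′ p∈ i′ i′≢j i′<i e

  lift : {k : ℕ} → Entry k → Entry (suc k)
  lift = map₁ (map₁ suc)

  -- Forgetting row zero loses just the lower bound set by its rim cell; `returns` supplies a later
  -- row ending in the same column, whose bound is stronger.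
  good-lift : {k : ℕ} {μ σ : Fin (suc k) → ℕ} → Slow μ → Peak μ zero → Increasing σ →
    {F : List (Entry k)} → InDiagram (tail μ) F → Good μ σ (map lift F) ⇔ Good (tail μ) (tail σ) F
  good-lift {k} {μ} {σ} slow peak inc {F} F⊆μ = mk⇔ to from
    where
    to : Good μ σ (map lift F) → Good (tail μ) (tail σ) F
    to (semi , bnd) =
      (λ p∈ q∈ → let row , col = semi (∈-map⁺ lift p∈) (∈-map⁺ lift q∈) in
         row ∘ cong suc , col ∘ s≤s) ,
      λ p∈ → let upper , lower = bnd (∈-map⁺ lift p∈) in
         upper , λ i′ i′<i → lower (suc i′) (s≤s i′<i)
    from : Good (tail μ) (tail σ) F → Good μ σ (map lift F)
    from (semi , bnd) = compat , bounds
      where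
      compat : Semistd (map lift F)
      compat p∈ q∈ with ∈-map⁻ lift p∈ | ∈-map⁻ lift q∈
      ... | p , p∈F , refl | q , q∈F , refl = let row , col = semi p∈F q∈F in
        row ∘ Fin.suc-injective , col ∘ ℕ.≤-pred
      bounds : ∀ {p} → p ∈ map lift F → Bounds μ σ p
      bounds p∈ with ∈-map⁻ lift p∈
      ... | ((i , c) , v) , p∈F , refl = proj₁ (bnd p∈F) , lower
        where
        lower : ∀ i′ → i′ Fin.< suc i → c ≡ μ i′ → σ i′ ≤ toℕ v
        lower (suc i′) (s≤s i′<i) e = proj₂ (bnd p∈F) i′ i′<i e
        lower zero _ refl with returns μ slow zero (descends peak) (suc i) (s≤s z≤n) (F⊆μ p∈F)
        ... | suc i′ , 0<i′ , s≤s i′<i , e =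
          ℕ.≤-trans (ℕ.<⇒≤ (inc zero (suc i′) 0<i′)) (proj₂ (bnd p∈F) i′ i′<i (sym e))

-- Tableaux as fillings

module _ {n : ℕ} where

  rowEntries : {k m : ℕ} → Fin k → ℕ → Vec (Fin n) m → List (Entry {n} k)
  rowEntries i c []      = []
  rowEntries i c (v ∷ r) = ((i , c) , v) ∷ rowEntries i (suc c) r

  entries : {k : ℕ} {lam : Fin k → ℕ} → Tableau n k lam → List (Entry {n} k)
  entries {zero}  T = []
  entries {suc k} T = rowEntries zero 0 (T zero) ++ map lift (entries (λ i → T (suc i)))

  ∈-rowEntries⁺ : {k m : ℕ} (i : Fin k) (c : ℕ) (r : Vec (Fin n) m) (a : Fin m) →
    ((i , c ℕ.+ toℕ a) , lookup r a) ∈ rowEntries i c r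
  ∈-rowEntries⁺ i c (v ∷ r) zero    rewrite ℕ.+-identityʳ c = here refl
  ∈-rowEntries⁺ i c (v ∷ r) (suc a) rewrite ℕ.+-suc c (toℕ a) = there (∈-rowEntries⁺ i (suc c) r a)

  ∈-rowEntries⁻ : {k m : ℕ} {i : Fin k} (c : ℕ) (r : Vec (Fin n) m) {p : Entry k} →
    p ∈ rowEntries i c r → ∃ λ a → p ≡ ((i , c ℕ.+ toℕ a) , lookup r a)
  ∈-rowEntries⁻ {i = i} c (v ∷ r) (here refl) = zero , cong (λ c → (i , c) , v) (sym (ℕ.+-identityʳ c))
  ∈-rowEntries⁻ {i = i} c (v ∷ r) (there p∈) with ∈-rowEntries⁻ (suc c) r p∈
  ... | a , refl = suc a , cong (λ c → (i , c) , lookup r a) (sym (ℕ.+-suc c (toℕ a)))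

  ∈-entries⁺ : {k : ℕ} {lam : Fin k → ℕ} (T : Tableau n k lam) (i : Fin k) (a : Fin (lam i)) →
    ((i , toℕ a) , lookup (T i) a) ∈ entries T
  ∈-entries⁺ T zero    a = ∈-++⁺ˡ (∈-rowEntries⁺ zero 0 (T zero) a)
  ∈-entries⁺ T (suc i) a = ∈-++⁺ʳ _ (∈-map⁺ lift (∈-entries⁺ (λ i → T (suc i)) i a))

  ∈-entries⁻ : {k : ℕ} {lam : Fin k → ℕ} (T : Tableau n k lam) {p : Entry k} →
    p ∈ entries T → ∃ λ i → ∃ λ a → p ≡ ((i , toℕ a) , lookup (T i) a)
  ∈-entries⁻ {suc k} T p∈ with ∈-++⁻ (rowEntries zero 0 (T zero)) p∈
  ... | inj₁ p∈row = zero , ∈-rowEntries⁻ 0 (T zero) p∈row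
  ... | inj₂ p∈rest with ∈-map⁻ lift p∈rest
  ...   | q , q∈ , refl with ∈-entries⁻ (λ i → T (suc i)) q∈
  ...     | i , a , refl = suc i , a , refl

  Surface : {k : ℕ} → (Fin k → ℕ) → (Fin k → Fin n) → Entry k → Set
  Surface lam s ((i , c) , v) = c ≡ lam i ∸ 1 → v ≡ s i

  SemistdSurface : {k : ℕ} → (Fin k → ℕ) → (Fin k → Fin n) → List (Entry k) → Set
  SemistdSurface lam s F = Semistd F × (∀ {p} → p ∈ F → Surface lam s p)

  semistdSurface? : {k : ℕ} (lam : Fin k → ℕ) (s : Fin k → Fin n) (F : List (Entry k)) →
    Dec (SemistdSurface lam s F)
  semistdSurface? lam s F = semistd? F ×-dec map′ All.lookup All.tabulate
    (All.all? (λ { ((i , c) , v) → (c ℕ.≟ (lam i ∸ 1)) →-dec (v Fin.≟ s i) }) F)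

  inSST⇔ : {k : ℕ} {lam : Fin k → ℕ} {s : Fin k → Fin n} (T : Tableau n k lam) →
    InSST s T ⇔ SemistdSurface lam s (entries T)
  inSST⇔ {lam = lam} {s} T = mk⇔ to from
    where
    to : InSST s T → SemistdSurface lam s (entries T)
    to ((rows , cols) , surf) = semi , surface
      where
      semi : Semistd (entries T)
      semi p∈ q∈ with ∈-entries⁻ T p∈ | ∈-entries⁻ T q∈
      ... | i , a , refl | i′ , a′ , refl = (λ { refl → rows i a a′ }) , λ i<i′ → cols i i′ i<i′ a a′
      surface : ∀ {p} → p ∈ entries T → Surface lam s p
      surface p∈ with ∈-entries⁻ T p∈
      ... | i , a , refl = surf i a
    from : SemistdSurface lam s (entries T) → InSST s T
    from (semi , surface) =
      ((λ i a a′ → proj₁ (semi (∈-entries⁺ T i a) (∈-entries⁺ T i a′)) refl) ,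
       (λ i i′ i<i′ a a′ → proj₂ (semi (∈-entries⁺ T i a) (∈-entries⁺ T i′ a′)) i<i′)) ,
      λ i a → surface (∈-entries⁺ T i a)

  -- With a single row the column conditions are vacuous, so a monomial is the same as a one-row
  -- filling.
  monomialsOK⇔ : {m r : ℕ} (v : Vec (Fin n) m) →
    (WeaklyIncreasing v × BoundedBy r v) ⇔ Good {k = 1} (const m) (const r) (rowEntries zero 0 v)
  monomialsOK⇔ {m} {r} v = mk⇔ to from
    where
    to : WeaklyIncreasing v × BoundedBy r v → Good (const m) (const r) (rowEntries zero 0 v)
    to (weak , bounded) = semi , bounds
      where
      semi : Semistd (rowEntries zero 0 v)
      semi p∈ q∈ with ∈-rowEntries⁻ 0 v p∈ | ∈-rowEntries⁻ 0 v q∈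
      ... | a , refl | b , refl = (λ _ → weak a b) , λ ()
      bounds : ∀ {p} → p ∈ rowEntries zero 0 v → Bounds (const m) (const r) p
      bounds p∈ with ∈-rowEntries⁻ 0 v p∈
      ... | a , refl = bounded a , λ _ ()
    from : Good (const m) (const r) (rowEntries zero 0 v) → WeaklyIncreasing v × BoundedBy r v
    from (semi , bounds) =
      (λ a b → proj₁ (semi (∈-rowEntries⁺ zero 0 v a) (∈-rowEntries⁺ zero 0 v b)) refl) ,
      λ a → proj₁ (bounds (∈-rowEntries⁺ zero 0 v a))

  graph : {A : Set} → (A → Fin n) → List A → List (A × Fin n)
  graph φ = map (λ p → p , φ p)

  -- `Bounds` lists the comparisons of an inner cell with the rim cells in its row and above it. For
  -- a rim cell below it, the inner value is at most the surface entry of its own row, and `s`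
  -- increases.
  rim-good : {k : ℕ} {lam μ : Fin k → ℕ} {s : Fin k → Fin n} → StrictlyIncreasing s →
    (∀ i → lam i ≡ suc (μ i)) → {F : List (Entry k)} → InDiagram μ F →
    SemistdSurface lam s (graph (s ∘ proj₁) (rim μ) ++ F) ⇔ Good μ (suc ∘ toℕ ∘ s) F
  rim-good {k} {lam} {μ} {s} inc lam≡ {F} F⊆μ = mk⇔ to from
    where
    G : List (Entry k)
    G = graph (s ∘ proj₁) (rim μ)
    ∈-G : ∀ i → ((i , μ i) , s i) ∈ G ++ F
    ∈-G i = ∈-++⁺ˡ (∈-map⁺ _ (∈-rim⁺ μ i))
    data Origin : Entry k → Set where
      rim′  : ∀ i → Origin ((i , μ i) , s i)
      inner : ∀ {p} → p ∈ F → Origin p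
    origin : ∀ {p} → p ∈ G ++ F → Origin p
    origin p∈ with ∈-++⁻ G p∈
    ... | inj₂ p∈F = inner p∈F
    ... | inj₁ p∈G with ∈-map⁻ _ p∈G
    ...   | (i , c) , q∈ , refl with ∈-rim⁻ μ q∈
    ...     | refl = rim′ i
    to : SemistdSurface lam s (G ++ F) → Good μ (suc ∘ toℕ ∘ s) F
    to (semi , surface) =
      (λ p∈ q∈ → semi (∈-++⁺ʳ G p∈) (∈-++⁺ʳ G q∈)) ,
      λ p∈ → s≤s (proj₁ (semi (∈-++⁺ʳ G p∈) (∈-G _)) refl (F⊆μ p∈)) ,
             λ i′ i′<i e → proj₂ (semi (∈-G i′) (∈-++⁺ʳ G p∈)) i′<i (sym e)
    from : Good μ (suc ∘ toℕ ∘ s) F → SemistdSurface lam s (G ++ F)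
    from (semi , bnd) = (λ p∈ q∈ → compat (origin p∈) (origin q∈)) , λ p∈ → surface (origin p∈)
      where
      compat : ∀ {p q} → Origin p → Origin q → Compatible p q
      compat (rim′ i) (rim′ i′) =
        (λ { refl μ<μ → contradiction μ<μ (ℕ.<-irrefl refl) }) , λ i<i′ _ → inc i i′ i<i′
      compat (rim′ i) (inner q∈) =
        (λ { refl μ<c → contradiction (F⊆μ q∈) (ℕ.<-asym μ<c) }) ,
        λ i<i′ e → proj₂ (bnd q∈) i i<i′ (sym e)
      compat (inner p∈) (rim′ i′) =
        (λ { refl _ → ℕ.≤-pred (proj₁ (bnd p∈)) }) ,
        λ i<i′ _ → ℕ.<-≤-trans (proj₁ (bnd p∈)) (inc _ i′ i<i′)
      compat (inner p∈) (inner q∈) = semi p∈ q∈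
      surface : ∀ {p} → Origin p → Surface lam s p
      surface (rim′ i) _ = refl
      surface {(i , c) , v} (inner p∈) c≡ =
        contradiction (trans c≡ (cong (_∸ 1) (lam≡ i))) (ℕ.<⇒≢ (F⊆μ p∈))

-- Sums and determinants

-- Deleting one or the other of two adjacent columns gives the same matrix except for which of the
-- two survives. If they are equal, the two minors agree.
punchIn-adjacent : {k : ℕ} (p b : Fin k) →
  punchIn (inject₁ p) b ≡ punchIn (suc p) b
  ⊎ punchIn (inject₁ p) b ≡ suc p × punchIn (suc p) b ≡ inject₁ p
punchIn-adjacent zero    zero    = inj₂ (refl , refl)
punchIn-adjacent zero    (suc b) = inj₁ refl
punchIn-adjacent (suc p) zero    = inj₁ refl
punchIn-adjacent (suc p) (suc b) with punchIn-adjacent p b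
... | inj₁ e        = inj₁ (cong suc e)
... | inj₂ (e , e′) = inj₂ (cong suc e , cong suc e′)

-- Deleting a third column keeps the pair adjacent, which lets the argument for equal columns
-- recurse into the minors.
punchIn-avoids : {k : ℕ} (p : Fin (suc k)) (q : Fin (suc (suc k))) → q ≢ inject₁ p → q ≢ suc p →
  ∃ λ p′ → punchIn q (inject₁ p′) ≡ inject₁ p × punchIn q (suc p′) ≡ suc p
punchIn-avoids zero zero q≢ _ = contradiction refl q≢
punchIn-avoids (suc p) zero _ _ = p , refl , refl
punchIn-avoids zero (suc zero) _ q≢ = contradiction refl q≢
punchIn-avoids {suc k} zero (suc (suc q)) _ _ = zero , refl , refl
punchIn-avoids {suc k} (suc p) (suc q) q≢ q≢′ =
  let p′ , e , e′ = punchIn-avoids p q (q≢ ∘ cong suc) (q≢′ ∘ cong suc)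
  in suc p′ , cong suc e , cong suc e′

module RingSums {c ℓ : Level} (R : CommutativeRing c ℓ) where
  open CommutativeRing R hiding (zero) renaming (refl to ≈-refl; sym to ≈-sym; trans to ≈-trans)
  open WithRing R
  open import Relation.Binary.Reasoning.Setoid setoid
  open import Algebra.Properties.Ring ring using (-‿distribˡ-*; +-identityʳ-unique)
  open import Algebra.Properties.CommutativeSemigroup *-commutativeSemigroup using (x∙yz≈y∙xz)
  open import Algebra.Properties.CommutativeSemigroup +-commutativeSemigroup using (interchange)

  Σ-cong : (k : ℕ) {f g : Fin k → Carrier} → (∀ i → f i ≈ g i) → ΣFin k f ≈ ΣFin k g
  Σ-cong zero    eq = ≈-refl
  Σ-cong (suc k) eq = +-cong (eq zero) (Σ-cong k (eq ∘ suc))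

  Σ-zero : (k : ℕ) {f : Fin k → Carrier} → (∀ i → f i ≈ 0#) → ΣFin k f ≈ 0#
  Σ-zero zero    eq = ≈-refl
  Σ-zero (suc k) eq = ≈-trans (+-cong (eq zero) (Σ-zero k (eq ∘ suc))) (+-identityˡ 0#)

  Σ-+ : (k : ℕ) (f g : Fin k → Carrier) → ΣFin k (λ i → f i + g i) ≈ ΣFin k f + ΣFin k g
  Σ-+ zero    f g = ≈-sym (+-identityˡ 0#)
  Σ-+ (suc k) f g = ≈-trans (+-congˡ (Σ-+ k (f ∘ suc) (g ∘ suc))) (interchange _ _ _ _)

  Σ-* : (k : ℕ) (y : Carrier) (f : Fin k → Carrier) → ΣFin k (λ i → y * f i) ≈ y * ΣFin k f
  Σ-* zero    y f = ≈-sym (zeroʳ y)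
  Σ-* (suc k) y f = ≈-trans (+-congˡ (Σ-* k y (f ∘ suc))) (≈-sym (distribˡ y _ _))

  Σ-comm : (k l : ℕ) (f : Fin k → Fin l → Carrier) →
    ΣFin k (λ i → ΣFin l (f i)) ≈ ΣFin l (λ j → ΣFin k (λ i → f i j))
  Σ-comm zero    l f = ≈-sym (Σ-zero l (λ _ → ≈-refl))
  Σ-comm (suc k) l f = ≈-trans (+-congˡ (Σ-comm k l (f ∘ suc))) (≈-sym (Σ-+ l _ _))

  Σ-single : {k : ℕ} (i₀ : Fin k) {f : Fin k → Carrier} → (∀ i → i ≢ i₀ → f i ≈ 0#) → ΣFin k f ≈ f i₀
  Σ-single {suc k} zero     eq = ≈-trans (+-congˡ (Σ-zero k (λ i → eq (suc i) λ ()))) (+-identityʳ _)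
  Σ-single {suc k} (suc i₀) eq = ≈-trans
    (+-cong (eq zero λ ()) (Σ-single i₀ (λ i i≢ → eq (suc i) (i≢ ∘ Fin.suc-injective))))
    (+-identityˡ _)

  sumL-cong : {A : Set} {f g : A → Carrier} (L : List A) → (∀ v → f v ≈ g v) →
    sumL (map f L) ≈ sumL (map g L)
  sumL-cong []      eq = ≈-refl
  sumL-cong (v ∷ L) eq = +-cong (eq v) (sumL-cong L eq)

  sumL-++ : (L M : List Carrier) → sumL (L ++ M) ≈ sumL L + sumL M
  sumL-++ []      M = ≈-sym (+-identityˡ _)
  sumL-++ (y ∷ L) M = ≈-trans (+-congˡ (sumL-++ L M)) (≈-sym (+-assoc _ _ _))

  sumL-concatMap : {A B : Set} (f : B → Carrier) (g : A → List B) (L : List A) →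
    sumL (map f (concatMap g L)) ≈ sumL (map (λ v → sumL (map f (g v))) L)
  sumL-concatMap f g []      = ≈-refl
  sumL-concatMap f g (v ∷ L) = begin
    sumL (map f (g v ++ concatMap g L))              ≡⟨ cong sumL (List.map-++ f (g v) _) ⟩
    sumL (map f (g v) ++ map f (concatMap g L))      ≈⟨ sumL-++ (map f (g v)) _ ⟩
    sumL (map f (g v)) + sumL (map f (concatMap g L)) ≈⟨ +-congˡ (sumL-concatMap f g L) ⟩
    _ ∎

  sumL-allFin : (k : ℕ) (f : Fin k → Carrier) → sumL (map f (List.allFin k)) ≈ ΣFin k f
  sumL-allFin k f = ≈-trans (reflexive (cong sumL (List.map-tabulate (λ i → i) f))) (go k f)
    where
    go : (k : ℕ) (f : Fin k → Carrier) → sumL (List.tabulate f) ≈ ΣFin k f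
    go zero    f = ≈-refl
    go (suc k) f = +-congˡ (go k (f ∘ suc))

  sumL-Σ : {A : Set} (k : ℕ) (f : Fin k → A → Carrier) (L : List A) →
    sumL (map (λ v → ΣFin k (λ i → f i v)) L) ≈ ΣFin k (λ i → sumL (map (f i) L))
  sumL-Σ k f []      = ≈-sym (Σ-zero k (λ _ → ≈-refl))
  sumL-Σ k f (v ∷ L) = ≈-trans (+-congˡ (sumL-Σ k f L)) (≈-sym (Σ-+ k _ _))

  when : {P : Set} → Dec P → Carrier → Carrier
  when p? w = if does p? then w else 0#

  when-⇔ : {P Q : Set} → P ⇔ Q → (p? : Dec P) (q? : Dec Q) {w w′ : Carrier} → w ≈ w′ →
    when p? w ≈ when q? w′
  when-⇔ P⇔Q p? q? w≈ rewrite does-⇔ P⇔Q p? q? with does q?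
  ... | true  = w≈
  ... | false = ≈-refl

  when-false : {P : Set} (p? : Dec P) {w : Carrier} → ¬ P → when p? w ≈ 0#
  when-false p? ¬p rewrite dec-false p? ¬p = ≈-refl

  when-true : {P : Set} (p? : Dec P) {w : Carrier} → P → when p? w ≈ w
  when-true p? p rewrite dec-true p? p = ≈-refl

  when-* : {P : Set} (p? : Dec P) (y w : Carrier) → y * when p? w ≈ when p? (y * w)
  when-* p? y w with does p?
  ... | true  = ≈-refl
  ... | false = zeroʳ y

  sumL-filter : {A : Set} {P : A → Set} (P? : ∀ v → Dec (P v)) (f : A → Carrier) (L : List A) →
    sumL (map f (filter P? L)) ≈ sumL (map (λ v → when (P? v) (f v)) L)
  sumL-filter P? f []      = ≈-refl
  sumL-filter P? f (v ∷ L) with does (P? v)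
  ... | true  = +-congˡ (sumL-filter P? f L)
  ... | false = ≈-trans (sumL-filter P? f L) (≈-sym (+-identityˡ _))

  module _ {n : ℕ} where

    -- Sums over all fillings of a list of cells

    ΣFill : {A : Set} → List A → (List (A × Fin n) → Carrier) → Carrier
    ΣFill []      f = f []
    ΣFill (p ∷ L) f = ΣFin n (λ v → ΣFill L (λ F → f ((p , v) ∷ F)))

    ΣFill-cong : {A : Set} (L : List A) {f g : List (A × Fin n) → Carrier} →
      (∀ F → map proj₁ F ≡ L → f F ≈ g F) → ΣFill L f ≈ ΣFill L g
    ΣFill-cong []      eq = eq [] refl
    ΣFill-cong (p ∷ L) eq = Σ-cong n (λ v → ΣFill-cong L (λ F F≡ → eq ((p , v) ∷ F) (cong (p ∷_) F≡)))

    ΣFill-zero : {A : Set} (L : List A) {f : List (A × Fin n) → Carrier} →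
      (∀ F → map proj₁ F ≡ L → f F ≈ 0#) → ΣFill L f ≈ 0#
    ΣFill-zero []      eq = eq [] refl
    ΣFill-zero (p ∷ L) eq = Σ-zero n (λ v → ΣFill-zero L (λ F F≡ → eq ((p , v) ∷ F) (cong (p ∷_) F≡)))

    ΣFill-+ : {A : Set} (L : List A) (f g : List (A × Fin n) → Carrier) →
      ΣFill L (λ F → f F + g F) ≈ ΣFill L f + ΣFill L g
    ΣFill-+ []      f g = ≈-refl
    ΣFill-+ (p ∷ L) f g = ≈-trans (Σ-cong n (λ v → ΣFill-+ L _ _)) (Σ-+ n _ _)

    ΣFill-* : {A : Set} (L : List A) (y : Carrier) (f : List (A × Fin n) → Carrier) →
      ΣFill L (λ F → y * f F) ≈ y * ΣFill L f
    ΣFill-* []      y f = ≈-refl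
    ΣFill-* (p ∷ L) y f = ≈-trans (Σ-cong n (λ v → ΣFill-* L y _)) (Σ-* n y _)

    ΣFill-++ : {A : Set} (L M : List A) (f : List (A × Fin n) → Carrier) →
      ΣFill (L ++ M) f ≈ ΣFill L (λ F → ΣFill M (λ G → f (F ++ G)))
    ΣFill-++ []      M f = ≈-refl
    ΣFill-++ (p ∷ L) M f = Σ-cong n (λ v → ΣFill-++ L M _)

    ΣFill-map : {A B : Set} (g : A → B) (L : List A) (f : List (B × Fin n) → Carrier) →
      ΣFill (map g L) f ≈ ΣFill L (f ∘ map (map₁ g))
    ΣFill-map g []      f = ≈-refl
    ΣFill-map g (p ∷ L) f = Σ-cong n (λ v → ΣFill-map g L _)

    ΣFill-↭ : {A : Set} {L M : List A} → L ↭ M → {f : List (A × Fin n) → Carrier} →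
      (∀ {F G} → F ↭ G → f F ≈ f G) → ΣFill L f ≈ ΣFill M f
    ΣFill-↭ ↭.refl resp = ≈-refl
    ΣFill-↭ (prep p L↭M) resp = Σ-cong n (λ v → ΣFill-↭ L↭M (λ F↭G → resp (prep _ F↭G)))
    ΣFill-↭ {A} {p ∷ q ∷ L} {_ ∷ _ ∷ M} (swap p q L↭M) {f} resp = begin
      ΣFin n (λ v → ΣFin n (λ w → ΣFill L (λ F → f ((p , v) ∷ (q , w) ∷ F)))) ≈⟨ Σ-comm n n _ ⟩
      ΣFin n (λ w → ΣFin n (λ v → ΣFill L (λ F → f ((p , v) ∷ (q , w) ∷ F))))
        ≈⟨ Σ-cong n (λ w → Σ-cong n (λ v → ≈-trans
             (ΣFill-cong L (λ F _ → resp (swap (p , v) (q , w) ↭.refl)))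
             (ΣFill-↭ L↭M (λ F↭G → resp (prep _ (prep _ F↭G)))))) ⟩
      ΣFin n (λ w → ΣFin n (λ v → ΣFill M (λ F → f ((q , w) ∷ (p , v) ∷ F)))) ∎
    ΣFill-↭ (↭.trans L↭M M↭N) resp = ≈-trans (ΣFill-↭ L↭M resp) (ΣFill-↭ M↭N resp)

    ΣFill-forced : {A : Set} (φ : A → Fin n) (L : List A) {f : List (A × Fin n) → Carrier} →
      (∀ F → map proj₁ F ≡ L → Any (λ (p , v) → v ≢ φ p) F → f F ≈ 0#) →
      ΣFill L f ≈ f (graph φ L)
    ΣFill-forced φ []      vanish = ≈-refl
    ΣFill-forced φ (p ∷ L) vanish = ≈-trans
      (Σ-single (φ p) (λ v v≢ → ΣFill-zero L (λ F F≡ → vanish _ (cong (p ∷_) F≡) (here v≢))))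
      (ΣFill-forced φ L (λ F F≡ bad → vanish _ (cong (p ∷_) F≡) (there bad)))

    ΣFill-allVecs : {k : ℕ} (i : Fin k) (c m : ℕ) {f : Vec (Fin n) m → Carrier}
      {g : List (Entry {n} k) → Carrier} → (∀ v → f v ≈ g (rowEntries i c v)) →
      sumL (map f (allVecs n m)) ≈ ΣFill (rowCells i c m) g
    ΣFill-allVecs i c zero    f≈g = ≈-trans (+-identityʳ _) (f≈g [])
    ΣFill-allVecs i c (suc m) {f} {g} f≈g = begin
      sumL (map f (concatMap (λ v → map (_∷ v) (List.allFin n)) (allVecs n m)))
        ≈⟨ sumL-concatMap f _ (allVecs n m) ⟩
      sumL (map (λ v → sumL (map f (map (_∷ v) (List.allFin n)))) (allVecs n m))
        ≈⟨ sumL-cong (allVecs n m) (λ v → ≈-trans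
             (reflexive (cong sumL (sym (List.map-∘ (List.allFin n))))) (sumL-allFin n (f ∘ (_∷ v)))) ⟩
      sumL (map (λ v → ΣFin n (λ a → f (a ∷ v))) (allVecs n m))
        -- `allVecs` runs over the first entry innermost, `ΣFill` over the first cell outermost.
        ≈⟨ sumL-Σ n (λ a v → f (a ∷ v)) (allVecs n m) ⟩
      ΣFin n (λ a → sumL (map (λ v → f (a ∷ v)) (allVecs n m)))
        ≈⟨ Σ-cong n (λ a → ΣFill-allVecs i (suc c) m (λ v → f≈g (a ∷ v))) ⟩
      ΣFill (rowCells i c (suc m)) g ∎

    ΣFill-allTableaux : {k : ℕ} (lam : Fin k → ℕ) {f : Tableau n k lam → Carrier}
      {g : List (Entry {n} k) → Carrier} → (∀ T → f T ≈ g (entries T)) →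
      sumL (map f (allTableaux n k lam)) ≈ ΣFill (cells lam) g
    ΣFill-allTableaux {zero}  lam f≈g = ≈-trans (+-identityʳ _) (f≈g _)
    ΣFill-allTableaux {suc k} lam {f} {g} f≈g = begin
      sumL (map f (allTableaux n (suc k) lam))
        ≈⟨ sumL-concatMap f _ (allVecs n (lam zero)) ⟩
      _ ≈⟨ ΣFill-allVecs zero 0 (lam zero) (λ r → ≈-trans
             (reflexive (cong sumL (sym (List.map-∘ (allTableaux n k (tail lam))))))
             (ΣFill-allTableaux (tail lam) (λ T → f≈g _))) ⟩
      ΣFill (rowCells zero 0 (lam zero)) (λ F → ΣFill (cells (tail lam)) (λ G → g (F ++ map lift G)))
        ≈⟨ ΣFill-cong (rowCells zero 0 (lam zero)) (λ F _ → ΣFill-map (map₁ suc) (cells (tail lam)) _) ⟨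
      ΣFill (rowCells zero 0 (lam zero)) (λ F → ΣFill (map (map₁ suc) (cells (tail lam))) (λ G → g (F ++ G)))
        ≈⟨ ΣFill-++ (rowCells zero 0 (lam zero)) _ g ⟨
      ΣFill (cells lam) g ∎

  -- Linearity and alternation of the determinant

  det-cong : (k : ℕ) {M N : Fin k → Fin k → Carrier} → (∀ i j → M i j ≈ N i j) → det k M ≈ det k N
  det-cong zero    eq = ≈-refl
  det-cong (suc k) eq = Σ-cong (suc k) (λ q →
    *-congˡ {sign (toℕ q)} (*-cong (eq zero q) (det-cong k (λ i b → eq (suc i) (punchIn q b)))))

  *-linear : (s u y w : Carrier) → s * (u + y * w) ≈ s * u + y * (s * w)
  *-linear s u y w = ≈-trans (distribˡ s u (y * w)) (+-congˡ (x∙yz≈y∙xz s y w))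

  -- In the expansion along the first row, summand `j` splits in its entry, every other summand in
  -- its minor, where column `j` has moved to `punchOut q≢j`.
  det-linear : (k : ℕ) (j : Fin k) (y : Carrier) {L M N : Fin k → Fin k → Carrier} →
    (∀ i → L i j ≈ M i j + y * N i j) →
    (∀ i b → b ≢ j → L i b ≈ M i b) → (∀ i b → b ≢ j → L i b ≈ N i b) →
    det k L ≈ det k M + y * det k N
  det-linear (suc k) j y {L} {M} {N} lin L≈M L≈N = begin
    ΣFin (suc k) (term L)                               ≈⟨ Σ-cong (suc k) step ⟩
    ΣFin (suc k) (λ q → term M q + y * term N q)        ≈⟨ Σ-+ (suc k) (term M) (λ q → y * term N q) ⟩
    ΣFin (suc k) (term M) + ΣFin (suc k) (λ q → y * term N q) ≈⟨ +-congˡ (Σ-* (suc k) y (term N)) ⟩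
    ΣFin (suc k) (term M) + y * ΣFin (suc k) (term N)   ∎
    where
    minor : (Fin (suc k) → Fin (suc k) → Carrier) → Fin (suc k) → Carrier
    minor A q = det k (λ i b → A (suc i) (punchIn q b))
    term : (Fin (suc k) → Fin (suc k) → Carrier) → Fin (suc k) → Carrier
    term A q = sign (toℕ q) * (A zero q * minor A q)
    step : ∀ q → term L q ≈ term M q + y * term N q
    step q with q Fin.≟ j
    ... | yes refl = ≈-trans
      (*-congˡ (begin
        L zero j * minor L j                            ≈⟨ *-congʳ (lin zero) ⟩
        (M zero j + y * N zero j) * minor L j           ≈⟨ distribʳ _ _ _ ⟩
        M zero j * minor L j + y * N zero j * minor L j ≈⟨ +-congˡ (*-assoc _ _ _) ⟩
        M zero j * minor L j + y * (N zero j * minor L j)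
          ≈⟨ +-cong (*-congˡ (det-cong k (λ i b → L≈M (suc i) (punchIn j b) (Fin.punchInᵢ≢i j b))))
                    (*-congˡ (*-congˡ (det-cong k (λ i b → L≈N (suc i) (punchIn j b) (Fin.punchInᵢ≢i j b))))) ⟩
        M zero j * minor M j + y * (N zero j * minor N j) ∎))
      (*-linear _ _ _ _)
    ... | no q≢j = ≈-trans
      (*-congˡ (begin
        L zero q * minor L q                            ≈⟨ *-congˡ (det-linear k (Fin.punchOut q≢j) y
             (λ i → subst (λ b → L (suc i) b ≈ M (suc i) b + y * N (suc i) b)
                      (sym (Fin.punchIn-punchOut q≢j)) (lin (suc i)))
             (λ i b b≢ → L≈M (suc i) (punchIn q b) (other b b≢))
             (λ i b b≢ → L≈N (suc i) (punchIn q b) (other b b≢))) ⟩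
        L zero q * (minor M q + y * minor N q)          ≈⟨ *-linear _ _ _ _ ⟩
        L zero q * minor M q + y * (L zero q * minor N q)
          ≈⟨ +-cong (*-congʳ (L≈M zero q q≢j)) (*-congˡ (*-congʳ (L≈N zero q q≢j))) ⟩
        M zero q * minor M q + y * (N zero q * minor N q) ∎))
      (*-linear _ _ _ _)
      where
      other : ∀ b → b ≢ Fin.punchOut q≢j → punchIn q b ≢ j
      other b b≢ e = b≢ (Fin.punchIn-injective q _ _ (trans e (sym (Fin.punchIn-punchOut q≢j))))

  -- Linearity with `M` in all three roles and factor 1 reads det M = det M + det M.
  det-zero-column : (k : ℕ) (j : Fin k) {M : Fin k → Fin k → Carrier} →
    (∀ i → M i j ≈ 0#) → det k M ≈ 0#
  det-zero-column k j {M} zero-col = ≈-trans (≈-sym (*-identityˡ _)) (+-identityʳ-unique (det k M) _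
    (≈-sym (det-linear k j 1#
      (λ i → ≈-sym (≈-trans (+-congˡ (≈-trans (*-identityˡ _) (zero-col i))) (+-identityʳ _)))
      (λ _ _ _ → ≈-refl) (λ _ _ _ → ≈-refl))))

  Σ-cancel : {k : ℕ} (p : Fin k) {f : Fin (suc k) → Carrier} → f (inject₁ p) + f (suc p) ≈ 0# →
    (∀ q → q ≢ inject₁ p → q ≢ suc p → f q ≈ 0#) → ΣFin (suc k) f ≈ 0#
  Σ-cancel {suc k} zero pair others = ≈-trans
    (+-congˡ (≈-trans (+-congˡ (Σ-zero k (λ q → others (suc (suc q)) (λ ()) (λ ())))) (+-identityʳ _)))
    pair
  Σ-cancel {suc k} (suc p) pair others = ≈-trans
    (+-cong (others zero (λ ()) (λ ()))
            (Σ-cancel p pair (λ q q≢ q≢′ →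
               others (suc q) (q≢ ∘ Fin.suc-injective) (q≢′ ∘ Fin.suc-injective))))
    (+-identityˡ _)

  -- The summands of the two columns cancel by their opposite signs, and all other minors still
  -- contain both columns. No division by 2 occurs, so any commutative ring will do.
  det-equal-columns : {k : ℕ} (p : Fin k) {M : Fin (suc k) → Fin (suc k) → Carrier} →
    (∀ i → M i (inject₁ p) ≈ M i (suc p)) → det (suc k) M ≈ 0#
  det-equal-columns {suc k} p {M} eq = Σ-cancel p pair others
    where
    minor : Fin (suc (suc k)) → Carrier
    minor q = det (suc k) (λ i b → M (suc i) (punchIn q b))
    same-column : ∀ i b → M (suc i) (punchIn (inject₁ p) b) ≈ M (suc i) (punchIn (suc p) b)
    same-column i b with punchIn-adjacent p b
    ... | inj₁ e         = reflexive (cong (M (suc i)) e)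
    ... | inj₂ (e , e′) rewrite e | e′ = ≈-sym (eq (suc i))
    pair : sign (toℕ (inject₁ p)) * (M zero (inject₁ p) * minor (inject₁ p))
         + - sign (toℕ p) * (M zero (suc p) * minor (suc p)) ≈ 0#
    pair = begin
      sign (toℕ (inject₁ p)) * (M zero (inject₁ p) * minor (inject₁ p)) + - sign (toℕ p) * y
        ≈⟨ +-congʳ (*-cong (reflexive (cong sign (Fin.toℕ-inject₁ p)))
                           (*-cong (eq zero) (det-cong (suc k) same-column))) ⟩
      sign (toℕ p) * y + - sign (toℕ p) * y ≈⟨ +-congˡ (-‿distribˡ-* _ y) ⟨
      sign (toℕ p) * y + - (sign (toℕ p) * y) ≈⟨ -‿inverseʳ _ ⟩
      0# ∎
      where
      y : Carrier
      y = M zero (suc p) * minor (suc p)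
    others : ∀ q → q ≢ inject₁ p → q ≢ suc p → sign (toℕ q) * (M zero q * minor q) ≈ 0#
    others q q≢ q≢′ with punchIn-avoids p q q≢ q≢′
    ... | p′ , e , e′ = ≈-trans (*-congˡ (≈-trans (*-congˡ (det-equal-columns p′ {λ i b → M (suc i) (punchIn q b)} equal)) (zeroʳ _))) (zeroʳ _)
      where
      equal : ∀ i → M (suc i) (punchIn q (inject₁ p′)) ≈ M (suc i) (punchIn q (suc p′))
      equal i rewrite e | e′ = eq (suc i)

-- The induction

module TableauSum {c ℓ : Level} (R : CommutativeRing c ℓ) {n : ℕ} (x : Fin n → CommutativeRing.Carrier R) where
  open CommutativeRing R hiding (zero) renaming (refl to ≈-refl; sym to ≈-sym; trans to ≈-trans)
  open WithRing R
  open RingSums R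
  open import Relation.Binary.Reasoning.Setoid setoid
  open import Algebra.Properties.CommutativeSemigroup *-commutativeSemigroup using (x∙yz≈y∙xz)

  weight : {A : Set} → List (A × Fin n) → Carrier
  weight []            = 1#
  weight ((_ , v) ∷ F) = x v * weight F

  weight-++ : {A : Set} (F G : List (A × Fin n)) → weight (F ++ G) ≈ weight F * weight G
  weight-++ []            G = ≈-sym (*-identityˡ _)
  weight-++ ((_ , v) ∷ F) G = ≈-trans (*-congˡ (weight-++ F G)) (≈-sym (*-assoc _ _ _))

  weight-map : {A B : Set} (g : A → B) (F : List (A × Fin n)) → weight (map (map₁ g) F) ≡ weight F
  weight-map g []            = refl
  weight-map g ((_ , v) ∷ F) = cong (x v *_) (weight-map g F)

  weight-↭ : {A : Set} {F G : List (A × Fin n)} → F ↭ G → weight F ≈ weight G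
  weight-↭ ↭.refl = ≈-refl
  weight-↭ (prep _ F↭G) = *-congˡ (weight-↭ F↭G)
  weight-↭ (swap (_ , v) (_ , w) F↭G) =
    ≈-trans (x∙yz≈y∙xz (x v) (x w) _) (*-congˡ (*-congˡ (weight-↭ F↭G)))
  weight-↭ (↭.trans F↭G G↭H) = ≈-trans (weight-↭ F↭G) (weight-↭ G↭H)

  weight-rowEntries : {k m : ℕ} (i : Fin k) (c : ℕ) (r : Vec (Fin n) m) →
    weight (rowEntries i c r) ≡ ΠFin m (λ a → x (lookup r a))
  weight-rowEntries i c []      = refl
  weight-rowEntries i c (v ∷ r) = cong (x v *_) (weight-rowEntries i (suc c) r)

  weight-entries : {k : ℕ} {lam : Fin k → ℕ} (T : Tableau n k lam) → weight (entries T) ≈ wt x T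
  weight-entries {zero}  T = ≈-refl
  weight-entries {suc k} T = ≈-trans (weight-++ (rowEntries zero 0 (T zero)) _)
    (*-cong (reflexive (weight-rowEntries zero 0 (T zero)))
            (≈-trans (reflexive (weight-map (map₁ suc) (entries (λ i → T (suc i)))))
                     (weight-entries (λ i → T (suc i)))))

  weight-rim : {k : ℕ} (μ : Fin k → ℕ) (s : Fin k → Fin n) →
    weight (graph (s ∘ proj₁) (rim μ)) ≡ ΠFin k (λ i → x (s i))
  weight-rim {zero}  μ s = refl
  weight-rim {suc k} μ s = cong (x (s zero) *_) (trans
    (trans (cong weight (trans (sym (List.map-∘ (rim (tail μ)))) (List.map-∘ (rim (tail μ)))))
             (weight-map (map₁ suc) (graph (s ∘ suc ∘ proj₁) (rim (tail μ)))))
    (weight-rim (tail μ) (s ∘ suc)))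

  -- The generating function of the fillings

  term : {k : ℕ} (μ σ : Fin k → ℕ) → List (Entry {n} k) → Carrier
  term μ σ F = when (good? μ σ F) (weight F)

  tableauSum : {k : ℕ} (μ σ : Fin k → ℕ) → Carrier
  tableauSum μ σ = ΣFill (cells μ) (term μ σ)

  term-↭ : {k : ℕ} {μ σ : Fin k → ℕ} {F G : List (Entry {n} k)} → F ↭ G → term μ σ F ≈ term μ σ G
  term-↭ {μ = μ} {σ} {F} {G} F↭G =
    when-⇔ (mk⇔ (good-resp-↭ F↭G) (good-resp-↭ (↭.↭-sym F↭G))) (good? μ σ F) (good? μ σ G) (weight-↭ F↭G)

  tableauSum-recurrence : {k : ℕ} {μ μ′ σ σ′ : Fin k → ℕ} {j : Fin k} →
    Slow μ → Peak μ j → Increasing σ → LowersAt j μ μ′ → LowersAt j σ σ′ →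
    (v : Fin n) → toℕ v ≡ σ′ j →
    tableauSum μ σ ≈ tableauSum μ σ′ + x v * tableauSum μ′ σ
  tableauSum-recurrence {k} {μ} {μ′} {σ} {σ′} {j} slow pk inc μ↓ σ↓ v v≡ = begin
    tableauSum μ σ
      -- Moving the corner to the front makes its value `a` the outermost summation variable.
      ≈⟨ ΣFill-↭ (cells-lowers μ↓) term-↭ ⟩
    ΣFin n (λ a → ΣFill (cells μ′) (λ F → term μ σ (((j , μ′ j) , a) ∷ F)))
      ≈⟨ Σ-cong n (λ a → ≈-trans (ΣFill-cong (cells μ′) (split a)) (ΣFill-+ (cells μ′) _ _)) ⟩
    ΣFin n (λ a → ΣFill (cells μ′) (λ F → term μ σ′ (((j , μ′ j) , a) ∷ F)) + ΣFill (cells μ′) (top a))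
      ≈⟨ Σ-+ n _ (λ a → ΣFill (cells μ′) (top a)) ⟩
    ΣFin n (λ a → ΣFill (cells μ′) (λ F → term μ σ′ (((j , μ′ j) , a) ∷ F)))
      + ΣFin n (λ a → ΣFill (cells μ′) (top a))
      ≈⟨ +-cong (≈-sym (ΣFill-↭ (cells-lowers μ↓) term-↭)) (≈-trans
           (Σ-single v (λ a a≢v → ΣFill-zero (cells μ′) (λ F _ → when-false (a Fin.≟ v) a≢v)))
           (≈-trans (ΣFill-cong (cells μ′) (λ F _ → when-true (v Fin.≟ v) refl))
                    (ΣFill-* (cells μ′) (x v) (term μ′ σ)))) ⟩
    tableauSum μ σ′ + x v * tableauSum μ′ σ ∎
    where
    top : Fin n → List (Entry {n} k) → Carrier
    top a F = when (a Fin.≟ v) (x v * term μ′ σ F)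
    split : ∀ a F → map proj₁ F ≡ cells μ′ →
      term μ σ (((j , μ′ j) , a) ∷ F) ≈ term μ σ′ (((j , μ′ j) , a) ∷ F) + top a F
    split a F F≡ with a Fin.≟ v
    ... | yes refl = begin
      term μ σ (corner ∷ F)
        ≈⟨ when-⇔ (corner-max v≡) (good? μ σ (corner ∷ F)) (good? μ′ σ F) ≈-refl ⟩
      when (good? μ′ σ F) (x v * weight F)
        ≈⟨ when-* (good? μ′ σ F) (x v) (weight F) ⟨
      x v * term μ′ σ F
        ≈⟨ +-identityˡ _ ⟨
      0# + x v * term μ′ σ F
        ≈⟨ +-congʳ (when-false (good? μ σ′ (corner ∷ F)) (corner-above v≡)) ⟨
      term μ σ′ (corner ∷ F) + x v * term μ′ σ F ∎
      where open Recurrence slow pk inc μ↓ σ↓ (inDiagram μ′ F≡) a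
    ... | no a≢v = ≈-trans
      (when-⇔ (corner-below (λ a≡ → a≢v (Fin.toℕ-injective (trans a≡ (sym v≡)))))
              (good? μ σ (corner ∷ F)) (good? μ σ′ (corner ∷ F)) ≈-refl)
      (≈-sym (+-identityʳ _))
      where open Recurrence slow pk inc μ↓ σ↓ (inDiagram μ′ F≡) a

  tableauSum-vanishes : {k : ℕ} {μ μ′ σ : Fin k → ℕ} {j : Fin k} → LowersAt j μ μ′ →
    (∀ v → ¬ Bounds {n} μ σ ((j , μ′ j) , v)) → tableauSum μ σ ≈ 0#
  tableauSum-vanishes {μ = μ} {μ′} {σ} {j} μ↓ ¬bounds =
    ΣFill-zero (cells μ) (λ F F≡ → when-false (good? μ σ F) (bad F F≡))
    where
    bad : ∀ F → map proj₁ F ≡ cells μ → ¬ Good μ σ F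
    bad F F≡ (_ , bnd)
      with ∈-map⁻ proj₁ (subst ((j , μ′ j) ∈_) (sym F≡) (↭.∈-resp-↭ (↭.↭-sym (cells-lowers μ↓)) (here refl)))
    ... | (_ , v) , p∈ , refl = ¬bounds v (bnd p∈)

  tableauSum-tail : {k : ℕ} {μ σ : Fin (suc k) → ℕ} → Slow μ → Peak μ zero → Increasing σ → μ zero ≡ 0 →
    tableauSum μ σ ≈ tableauSum (tail μ) (tail σ)
  tableauSum-tail {k} {μ} {σ} slow pk inc μ₀≡0 rewrite μ₀≡0 = ≈-trans
    (ΣFill-map (map₁ suc) (cells (tail μ)) (term μ σ))
    (ΣFill-cong (cells (tail μ)) (λ F F≡ →
      when-⇔ (good-lift slow pk inc (inDiagram (tail μ) F≡)) (good? μ σ (map lift F)) (good? (tail μ) (tail σ) F)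
             (reflexive (weight-map (map₁ suc) F))))

  -- Complete homogeneous polynomials and their determinant

  hN≈tableauSum : (r m : ℕ) → hN x r m ≈ tableauSum {1} (const m) (const r)
  hN≈tableauSum r m = begin
    hN x r m
      ≈⟨ sumL-filter (monomialsOK? r) _ (allVecs n m) ⟩
    sumL (map (λ v → when (monomialsOK? r v) (ΠFin m (λ a → x (lookup v a)))) (allVecs n m))
      ≈⟨ ΣFill-allVecs zero 0 m (λ v →
           when-⇔ (monomialsOK⇔ v) (monomialsOK? r v) (good? (const m) (const r) (rowEntries zero 0 v))
                  (reflexive (sym (weight-rowEntries zero 0 v)))) ⟩
    ΣFill (rowCells zero 0 m) (term (const m) (const r))
      ≡⟨ cong (λ L → ΣFill L (term (const m) (const r))) (List.++-identityʳ (rowCells zero 0 m)) ⟨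
    tableauSum {1} (const m) (const r) ∎

  hN-degree-zero : (r : ℕ) → hN x r 0 ≈ 1#
  hN-degree-zero r = ≈-trans (hN≈tableauSum r 0) ≈-refl

  hN-no-variables : (m : ℕ) → hN x 0 (suc m) ≈ 0#
  hN-no-variables m = ≈-trans (hN≈tableauSum 0 (suc m))
    (tableauSum-vanishes {1} {σ = const 0} (fin1-lowers m) (λ { v (() , _) }))

  hN-recurrence : (v : Fin n) (m : ℕ) →
    hN x (suc (toℕ v)) (suc m) ≈ hN x (toℕ v) (suc m) + x v * hN x (suc (toℕ v)) m
  hN-recurrence v m = begin
    hN x (suc (toℕ v)) (suc m)
      ≈⟨ hN≈tableauSum (suc (toℕ v)) (suc m) ⟩
    tableauSum {1} (const (suc m)) (const (suc (toℕ v)))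
      ≈⟨ tableauSum-recurrence (fin1-slow _) (fin1-peak _) (fin1-increasing _) (fin1-lowers m)
           (fin1-lowers (toℕ v)) v refl ⟩
    tableauSum {1} (const (suc m)) (const (toℕ v)) + x v * tableauSum {1} (const m) (const (suc (toℕ v)))
      ≈⟨ +-cong (hN≈tableauSum (toℕ v) (suc m)) (*-congˡ (hN≈tableauSum (suc (toℕ v)) m)) ⟨
    hN x (toℕ v) (suc m) + x v * hN x (suc (toℕ v)) m ∎

  -- h_{a − b}(x_1, …, x_r), computed without integers.
  hDiff : (r a b : ℕ) → Carrier
  hDiff r a       zero    = hN x r a
  hDiff r zero    (suc b) = 0#
  hDiff r (suc a) (suc b) = hDiff r a b

  h-⊖ : (r a b : ℕ) → h x r (a ℤ.⊖ b) ≡ hDiff r a b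
  h-⊖ r a       zero    = refl
  h-⊖ r zero    (suc b) = refl
  h-⊖ r (suc a) (suc b) = trans (cong (h x r) (ℤ.[1+m]⊖[1+n]≡m⊖n a b)) (h-⊖ r a b)

  hDiff-< : (r : ℕ) {a b : ℕ} → a < b → hDiff r a b ≡ 0#
  hDiff-< r {zero}  {suc b} _         = refl
  hDiff-< r {suc a} {suc b} (s≤s a<b) = hDiff-< r a<b

  hDiff-recurrence : (v : Fin n) (a b : ℕ) →
    hDiff (suc (toℕ v)) (suc a) b ≈ hDiff (toℕ v) (suc a) b + x v * hDiff (suc (toℕ v)) a b
  hDiff-recurrence v a       zero          = hN-recurrence v a
  hDiff-recurrence v (suc a) (suc b)       = hDiff-recurrence v a b
  hDiff-recurrence v zero    (suc (suc b)) = ≈-sym (≈-trans (+-congˡ (zeroʳ _)) (+-identityʳ _))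
  -- Degree zero: both h_0 are 1, and the last term has degree -1.
  hDiff-recurrence v zero    (suc zero)    = begin
    hN x (suc (toℕ v)) 0       ≈⟨ hN-degree-zero (suc (toℕ v)) ⟩
    1#                         ≈⟨ hN-degree-zero (toℕ v) ⟨
    hN x (toℕ v) 0             ≈⟨ +-identityʳ _ ⟨
    hN x (toℕ v) 0 + 0#        ≈⟨ +-congˡ (zeroʳ (x v)) ⟨
    hN x (toℕ v) 0 + x v * 0#  ∎

  -- As μ = λ - 1, the degree λ_j - j + i - 1 is μ_j + i - j; counting `i` and `j` from zero does
  -- not change it.
  jacobiTrudi : {k : ℕ} (μ σ : Fin k → ℕ) → Fin k → Fin k → Carrier
  jacobiTrudi μ σ i j = hDiff (σ j) (μ j ℕ.+ toℕ i) (toℕ j)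

  det-recurrence : {k : ℕ} {μ μ′ σ σ′ : Fin k → ℕ} {j : Fin k} → LowersAt j μ μ′ → LowersAt j σ σ′ →
    (v : Fin n) → toℕ v ≡ σ′ j →
    det k (jacobiTrudi μ σ) ≈ det k (jacobiTrudi μ σ′) + x v * det k (jacobiTrudi μ′ σ)
  det-recurrence {k} {μ} {μ′} {σ} {σ′} {j} (μj≡ , μ-same) (σj≡ , σ-same) v v≡ =
    det-linear k j (x v) column
      (λ i b b≢j → reflexive (cong (λ r → hDiff r (μ b ℕ.+ toℕ i) (toℕ b)) (σ-same b b≢j)))
      (λ i b b≢j → reflexive (cong (λ m → hDiff (σ b) (m ℕ.+ toℕ i) (toℕ b)) (μ-same b b≢j)))
    where
    column : ∀ i → jacobiTrudi μ σ i j ≈ jacobiTrudi μ σ′ i j + x v * jacobiTrudi μ′ σ i j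
    column i rewrite μj≡ | σj≡ | sym v≡ = hDiff-recurrence v (μ′ j ℕ.+ toℕ i) (toℕ j)

  -- The first row is 1, 0, ..., 0, its later entries having negative degree. In the remaining minor
  -- the shifts of row and column index cancel.
  det-tail : {k : ℕ} {μ σ : Fin (suc k) → ℕ} → μ zero ≡ 0 → (∀ i → μ (suc i) ≤ toℕ i) →
    det (suc k) (jacobiTrudi μ σ) ≈ det k (jacobiTrudi (tail μ) (tail σ))
  det-tail {k} {μ} {σ} μ₀≡0 small = begin
    det (suc k) (jacobiTrudi μ σ)
      ≈⟨ Σ-single zero {summand} (λ { zero 0≢0 → contradiction refl 0≢0 ; (suc q) _ → vanishes q }) ⟩
    1# * (hDiff (σ zero) (μ zero ℕ.+ 0) 0 * det k (λ i b → jacobiTrudi μ σ (suc i) (suc b)))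
      ≈⟨ *-identityˡ _ ⟩
    hDiff (σ zero) (μ zero ℕ.+ 0) 0 * det k (λ i b → jacobiTrudi μ σ (suc i) (suc b))
      ≈⟨ *-cong (≈-trans (reflexive (cong (λ m → hN x (σ zero) (m ℕ.+ 0)) μ₀≡0)) (hN-degree-zero (σ zero)))
                (det-cong k (λ i b → reflexive
                   (cong (λ a → hDiff (σ (suc b)) a (suc (toℕ b))) (ℕ.+-suc (μ (suc b)) (toℕ i))))) ⟩
    1# * det k (jacobiTrudi (tail μ) (tail σ))
      ≈⟨ *-identityˡ _ ⟩
    det k (jacobiTrudi (tail μ) (tail σ)) ∎
    where
    summand : Fin (suc k) → Carrier
    summand q = sign (toℕ q) * (jacobiTrudi μ σ zero q * det k (λ i b → jacobiTrudi μ σ (suc i) (punchIn q b)))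
    vanishes : ∀ q → summand (suc q) ≈ 0#
    vanishes q = ≈-trans (*-congˡ (≈-trans (*-congʳ (reflexive
      (hDiff-< (σ (suc q)) (s≤s (subst (_≤ toℕ q) (sym (ℕ.+-identityʳ _)) (small q)))))) (zeroˡ _))) (zeroʳ _)

  -- Equality of both sides by induction

  JacobiTrudi : {k : ℕ} (μ σ : Fin k → ℕ) → Set ℓ
  JacobiTrudi {k} μ σ = tableauSum μ σ ≈ det k (jacobiTrudi μ σ)

  -- `bounded` makes `σ j ∸ 1` the index of a variable whenever `σ j` is positive. `σ zero` may be
  -- 0, which leaves no value for row zero.
  record Admissible {k : ℕ} (μ σ : Fin k → ℕ) : Set where
    constructor admissible
    field
      slow    : Slow μ
      inc     : Increasing σ
      bounded : ∀ i → σ i ≤ n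

  module Step {k : ℕ} {μ σ : Fin (suc k) → ℕ} (adm : Admissible μ σ)
    (IH-tail : {μ′ σ′ : Fin k → ℕ} → Admissible μ′ σ′ → JacobiTrudi μ′ σ′)
    (IH : {μ′ σ′ : Fin (suc k) → ℕ} → Admissible μ′ σ′ →
      suc (total μ′ ℕ.+ total σ′) ≡ total μ ℕ.+ total σ → JacobiTrudi μ′ σ′) where

    open Admissible adm

    strip-row : Peak μ zero → μ zero ≡ 0 → JacobiTrudi μ σ
    strip-row pk μ₀≡0 = begin
      tableauSum μ σ                             ≈⟨ tableauSum-tail slow pk inc μ₀≡0 ⟩
      tableauSum (tail μ) (tail σ)               ≈⟨ IH-tail (admissible (slow-tail slow)
                                                      (λ i j i<j → inc (suc i) (suc j) (s≤s i<j)) (bounded ∘ suc)) ⟩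
      det k (jacobiTrudi (tail μ) (tail σ))      ≈⟨ det-tail {k} {μ} {σ} μ₀≡0 (small slow pk μ₀≡0) ⟨
      det (suc k) (jacobiTrudi μ σ)              ∎
      where
      -- The peak at zero makes the second row empty too; from there each row gains at most one
      -- cell.
      small : {k : ℕ} {μ : Fin (suc k) → ℕ} → Slow μ → Peak μ zero → μ zero ≡ 0 → ∀ i → μ (suc i) ≤ toℕ i
      small {suc k} {μ} slow pk μ₀≡0 i = ℕ.≤-trans (slow-bound (tail μ) (slow-tail slow) i)
        (ℕ.+-monoˡ-≤ (toℕ i) (subst (μ (suc zero) ≤_) μ₀≡0 (descends pk (suc zero) refl)))

    -- No value fits in row zero, and column zero consists of polynomials of positive degree in no
    -- variables.
    no-values : ∀ {m} → μ zero ≡ suc m → σ zero ≡ 0 → JacobiTrudi μ σ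
    no-values {m} μ₀≡ σ₀≡0 = ≈-trans
      (tableauSum-vanishes (lowered μ zero μ₀≡) (λ v (v<σ , _) → ℕ.n≮0 (subst (toℕ v <_) σ₀≡0 v<σ)))
      (≈-sym (det-zero-column (suc k) zero {jacobiTrudi μ σ} column))
      where
      column : ∀ i → jacobiTrudi μ σ i zero ≈ 0#
      column i rewrite σ₀≡0 | μ₀≡ = hN-no-variables (m ℕ.+ toℕ i)

    module _ {j : Fin (suc k)} {μ′ σ′ : Fin (suc k) → ℕ}
      (pk : Peak μ j) (μ↓ : LowersAt j μ μ′) (σ↓ : LowersAt j σ σ′) where

      -- By `stepsUp` the last cell of row `j` lies under the rim cell of the row above, so its
      -- value would have to be both below `σ′ j` and at least that. In the determinant, the extra 1
      -- in `μ j` offsets the next column index.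
      collision : ∀ {p} → j ≡ suc p → σ′ j ≡ σ (inject₁ p) → JacobiTrudi μ σ′
      collision {p} refl e = ≈-trans (tableauSum-vanishes μ↓ ¬bounds) (≈-sym (det-equal-columns p {jacobiTrudi μ σ′} equal))
        where
        toℕ-p : suc (toℕ p) ≡ suc (toℕ (inject₁ p))
        toℕ-p = cong suc (sym (Fin.toℕ-inject₁ p))
        μ≡ : μ (suc p) ≡ suc (μ (inject₁ p))
        μ≡ = stepsUp pk (inject₁ p) toℕ-p
        p≢ : inject₁ p ≢ suc p
        p≢ e = ℕ.1+n≢n (trans (sym (cong toℕ e)) (Fin.toℕ-inject₁ p))
        σ≡ : σ′ (suc p) ≡ σ′ (inject₁ p)
        σ≡ = trans e (proj₂ σ↓ (inject₁ p) p≢)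
        ¬bounds : ∀ v → ¬ Bounds {n} μ σ′ ((suc p , μ′ (suc p)) , v)
        ¬bounds v (upper , lower) = ℕ.<⇒≱ upper (subst (_≤ toℕ v) (sym σ≡)
          (lower (inject₁ p) (ℕ.≤-reflexive (sym toℕ-p))
                 (ℕ.suc-injective (trans (sym (proj₁ μ↓)) μ≡))))
        equal : ∀ i → jacobiTrudi μ σ′ i (inject₁ p) ≈ jacobiTrudi μ σ′ i (suc p)
        equal i rewrite Fin.toℕ-inject₁ p | σ≡ | μ≡ = ≈-refl

      lower-row : JacobiTrudi μ σ
      lower-row = begin
        tableauSum μ σ
          ≈⟨ tableauSum-recurrence slow pk inc μ↓ σ↓ v v≡ ⟩
        tableauSum μ σ′ + x v * tableauSum μ′ σ
          ≈⟨ +-cong lower-σ (*-congˡ lower-μ) ⟩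
        det (suc k) (jacobiTrudi μ σ′) + x v * det (suc k) (jacobiTrudi μ′ σ)
          ≈⟨ det-recurrence μ↓ σ↓ v v≡ ⟨
        det (suc k) (jacobiTrudi μ σ) ∎
        where
        σ′<n : σ′ j < n
        σ′<n = subst (_≤ n) (proj₁ σ↓) (bounded j)
        v : Fin n
        v = Fin.fromℕ< σ′<n
        v≡ : toℕ v ≡ σ′ j
        v≡ = Fin.toℕ-fromℕ< σ′<n
        lower-μ : JacobiTrudi μ′ σ
        lower-μ = IH (admissible (slow-lowers slow pk μ↓) inc bounded)
          (cong (ℕ._+ total σ) (sym (total-lowers μ↓)))
        lower-σ : JacobiTrudi μ σ′
        lower-σ with collides? j inc σ↓
        ... | inj₁ below = IH
          (admissible slow (increasing-lowers inc σ↓ below) (λ i → ℕ.≤-trans (lowers-≤ σ↓ i) (bounded i)))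
          (sym (trans (cong (total μ ℕ.+_) (total-lowers σ↓)) (ℕ.+-suc _ _)))
        ... | inj₂ (p , j≡ , e) = collision j≡ e

    -- `m` and `r` are there to be matched on. Zero occurs only at the first index, since a later
    -- peak exceeds `μ zero` and `σ` increases.
    step-at : ∀ {m r} j → Peak μ j → μ j ≡ m → σ j ≡ r → JacobiTrudi μ σ
    step-at {zero}          zero    pk μj≡ _   = strip-row pk μj≡
    step-at {zero}          (suc j) pk μj≡ _   =
      contradiction (subst (μ zero <_) μj≡ (rises pk zero (s≤s z≤n))) ℕ.n≮0
    step-at {suc m} {zero}  zero    pk μj≡ σj≡ = no-values μj≡ σj≡
    step-at {suc m} {zero}  (suc j) pk μj≡ σj≡ =
      contradiction (subst (σ zero <_) σj≡ (inc zero (suc j) (s≤s z≤n))) ℕ.n≮0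
    step-at {suc m} {suc r} j       pk μj≡ σj≡ = lower-row pk (lowered μ j μj≡) (lowered σ j σj≡)

    step : JacobiTrudi μ σ
    step = let j , pk = peak μ slow in step-at j pk refl refl

  -- Dropping a row restarts with whatever total remains, so `k` is the outer and `N` the inner
  -- recursion. For k = 0 both sides compute to 1.
  tableauSum≈det : (k N : ℕ) {μ σ : Fin k → ℕ} → total μ ℕ.+ total σ ≡ N → Admissible μ σ → JacobiTrudi μ σ
  tableauSum≈det zero    N       N≡ adm = ≈-refl
  tableauSum≈det (suc k) zero    N≡ adm = Step.step adm (tableauSum≈det k _ refl)
    (λ _ e → contradiction (trans e N≡) λ ())
  tableauSum≈det (suc k) (suc N) N≡ adm = Step.step adm (tableauSum≈det k _ refl)
    (λ adm′ e → tableauSum≈det (suc k) N (ℕ.suc-injective (trans e N≡)) adm′)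

  -- Putting the surface back

  SST-sum : {k : ℕ} (lam μ : Fin k → ℕ) (s : Fin k → Fin n) → StrictlyIncreasing s →
    (∀ i → lam i ≡ suc (μ i)) →
    sumL (map (wt x) (SST n k lam s)) ≈ ΠFin k (λ i → x (s i)) * tableauSum μ (suc ∘ toℕ ∘ s)
  SST-sum {k} lam μ s inc lam≡ = begin
    sumL (map (wt x) (SST n k lam s))
      ≈⟨ sumL-filter (inSST? s) (wt x) (allTableaux n k lam) ⟩
    sumL (map (λ T → when (inSST? s T) (wt x T)) (allTableaux n k lam))
      ≈⟨ ΣFill-allTableaux lam (λ T →
           when-⇔ (inSST⇔ T) (inSST? s T) (semistdSurface? lam s (entries T)) (≈-sym (weight-entries T))) ⟩
    ΣFill (cells lam) summand
      ≈⟨ ΣFill-↭ (cells-rim lam≡) (λ {F} {G} F↭G →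
           when-⇔ (mk⇔ (resp F↭G) (resp (↭.↭-sym F↭G)))
                  (semistdSurface? lam s F) (semistdSurface? lam s G) (weight-↭ F↭G)) ⟩
    ΣFill (rim μ ++ cells μ) summand
      ≈⟨ ΣFill-++ (rim μ) (cells μ) summand ⟩
    ΣFill (rim μ) (λ S → ΣFill (cells μ) (λ F → summand (S ++ F)))
      -- A rim entry that differs from `s` violates the surface condition, so a single rim filling
      -- survives.
      ≈⟨ ΣFill-forced (s ∘ proj₁) (rim μ) (λ S S≡ wrong → ΣFill-zero (cells μ) (λ F _ →
           when-false (semistdSurface? lam s (S ++ F)) (λ (_ , surface) → wrong-surface S≡ wrong (surface ∘ ∈-++⁺ˡ)))) ⟩
    ΣFill (cells μ) (λ F → summand (graph (s ∘ proj₁) (rim μ) ++ F))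
      ≈⟨ ΣFill-cong (cells μ) (λ F F≡ → ≈-trans
           (when-⇔ (rim-good inc lam≡ (inDiagram μ F≡))
                   (semistdSurface? lam s (graph (s ∘ proj₁) (rim μ) ++ F)) (good? μ (suc ∘ toℕ ∘ s) F)
                   (≈-trans (weight-++ (graph (s ∘ proj₁) (rim μ)) F) (*-congʳ (reflexive (weight-rim μ s)))))
           (≈-sym (when-* (good? μ (suc ∘ toℕ ∘ s) F) _ (weight F)))) ⟩
    ΣFill (cells μ) (λ F → ΠFin k (λ i → x (s i)) * term μ (suc ∘ toℕ ∘ s) F)
      ≈⟨ ΣFill-* (cells μ) _ _ ⟩
    ΠFin k (λ i → x (s i)) * tableauSum μ (suc ∘ toℕ ∘ s) ∎
    where
    summand : List (Entry {n} k) → Carrier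
    summand F = when (semistdSurface? lam s F) (weight F)
    resp : ∀ {F G} → F ↭ G → SemistdSurface lam s F → SemistdSurface lam s G
    resp F↭G (semi , surface) = semistd-resp-↭ F↭G semi , surface ∘ ↭.∈-resp-↭ (↭.↭-sym F↭G)
    wrong-surface : ∀ {S} → map proj₁ S ≡ rim μ → Any (λ (p , v) → v ≢ s (proj₁ p)) S →
      ¬ (∀ {p} → p ∈ S → Surface lam s p)
    wrong-surface S≡ wrong surface with find wrong
    ... | ((i , c) , v) , p∈ , v≢ = v≢ (surface p∈ (trans
      (∈-rim⁻ μ (subst ((i , c) ∈_) S≡ (∈-map⁺ proj₁ p∈))) (sym (cong (_∸ 1) (lam≡ i)))))

open import Data.Nat using (ℕ)
open import Data.Integer using (+_; _+_; _-_; _⊖_)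

-- Here `suc m` is λ_j, and its extra unit cancels the -1; the form with `⊖` is what `h-⊖` converts
-- to `hDiff`.
h-index : (m i j : ℕ) → ((+ suc m) - (+ j)) + ((+ i) - (+ 1)) ≡ (m ℕ.+ i) ⊖ j
h-index m i j = begin
  ((+ suc m) - (+ j)) + ((+ i) - (+ 1))           ≡⟨⟩
  ((+ 1 + + m) - (+ j)) + ((+ i) - (+ 1))         ≡⟨ rearrange (+ m) (+ i) (+ j) ⟩
  (+ m + + i) - (+ j)                             ≡⟨ ℤ.m-n≡m⊖n (m ℕ.+ i) j ⟩
  (m ℕ.+ i) ⊖ j                                   ∎
  where
  open ≡-Reasoning
  rearrange : ∀ a b c → ((+ 1 + a) - c) + (b - (+ 1)) ≡ (a + b) - c
  rearrange = ℤ-Solver.solve-∀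

theorem5p3 : {c ℓ : Level} (R : CommutativeRing c ℓ) (n k : ℕ)
    (x : Fin n → CommutativeRing.Carrier R)
    (lam : Fin k → ℕ) (s : Fin k → Fin n) →
    IsPseudoPartition k lam → StrictlyIncreasing s →
    CommutativeRing._≈_ R
    (WithRing.sumL R (map (WithRing.wt R x) (SST n k lam s)))
    (CommutativeRing._*_ R
    (WithRing.ΠFin R k (λ i → x (s i)))
    (WithRing.det R k (λ i j →
    WithRing.h R x (toℕ (s j) Data.Nat.+ 1)
    (((+ lam j) - (+ toℕ j)) + ((+ toℕ i) - (+ 1))))))
theorem5p3 R n k x lam s (positive , slow) inc =
  ≈-trans (SST-sum lam μ s inc lam≡)
    (*-congˡ (≈-trans (tableauSum≈det k _ refl adm) (det-cong k (λ i j → reflexive (entry i j)))))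
  where
  open CommutativeRing R using (*-congˡ; reflexive) renaming (trans to ≈-trans)
  open WithRing R using (h)
  open RingSums R using (det-cong)
  open TableauSum R x
  μ : Fin k → ℕ
  μ i = lam i ∸ 1
  lam≡ : ∀ i → lam i ≡ suc (μ i)
  lam≡ i = sym (ℕ.m+[n∸m]≡n (positive i))
  adm : Admissible μ (suc ∘ toℕ ∘ s)
  adm = admissible
    (λ i j e → subst (μ j ≤_) (lam≡ i) (ℕ.∸-monoˡ-≤ 1 (slow i j e)))
    (λ i j i<j → s≤s (inc i j i<j))
    (λ i → Fin.toℕ<n (s i))
  entry : ∀ i j → jacobiTrudi μ (suc ∘ toℕ ∘ s) i j
    ≡ h x (toℕ (s j) ℕ.+ 1) (((+ lam j) - (+ toℕ j)) + ((+ toℕ i) - (+ 1)))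
  entry i j = sym (trans
    (cong₂ (h x) (ℕ.+-comm (toℕ (s j)) 1)
      (trans (cong (λ m → ((+ m) - (+ toℕ j)) + ((+ toℕ i) - (+ 1))) (lam≡ j)) (h-index (μ j) (toℕ i) (toℕ j))))
    (h-⊖ (suc (toℕ (s j))) (μ j ℕ.+ toℕ i) (toℕ j)))
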